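{- For all positive integers $k$ and $d$, there are only finitely many equivalence classes $[T(G,\bar g)]_{\equiv_{\mathsf{CTL}^*_d\setminus\mathsf{X}}}$, where $G$ ranges over all topologies and $\bar g$ over all $k$-tuples of distinct vertices of $G$.
   Context: A topology is a directed graph $G=(V,E,x)$ with $V=[n]$ for some $n\ge1$, initial vertex $x\in V$, and $E\subseteq V\times V$ without self-loops. For a $k$-tuple $\bar g=(g_1,\dots,g_k)$ of distinct vertices, the graph LTS $T(G,\bar g)$ is the labeled transition system with state set $V$, initial state $x$, a single action $a$, a transition $(v,a,w)$ iff $(v,w)\in E$, and labeling $\Lambda(v)=\{i\}$ if $v=g_i$ and $\Lambda(v)=\emptyset$ otherwise (atoms $1,\dots,k$). $\mathsf{CTL}^*_d\setminus\mathsf{X}$ is the fragment of $\mathsf{CTL}^*$ without the next-time operator with path-quantifier nesting depth at most $d$; $M\equiv_{\mathsf{CTL}^*_d\setminus\mathsf{X}}N$ iff $M$ and $N$ satisfy exactly the same $\mathsf{CTL}^*_d\setminus\mathsf{X}$ formulas. -}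

module Defs where

open import Data.Nat using (ℕ; zero; suc; _≤_; _<_)
open import Data.Fin using (Fin)
open import Data.Bool using (Bool; T; false)
open import Data.Maybe using (Maybe; just; nothing)
open import Data.Unit using (⊤)
open import Data.Empty using (⊥)
open import Data.Product using (Σ; _×_; _,_)
open import Data.List using (List)
open import Data.List.Relation.Unary.Any using (Any)
open import Relation.Binary.PropositionalEquality using (_≡_)
open import Relation.Nullary using (¬_)
open import Function.Definitions using (Injective)

-- Topologies: G = (V, E, x) with V = [n] (here Fin n), no self-loops.
-- (x : Fin n forces n ≥ 1.)

record Topology : Set where
  field
    n      : ℕ
    E      : Fin n → Fin n → Bool
    x      : Fin n
    noLoop : ∀ v → E v v ≡ false

open Topology public

Edge : (G : Topology) → Fin (n G) → Fin (n G) → Set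
Edge G v w = T (E G v w)

record Instance (k : ℕ) : Set where
  field
    G        : Topology
    g        : Fin k → Fin (n G)
    distinct : Injective _≡_ _≡_ g

open Instance public

-- Maximal paths of the graph LTS T(G, ḡ) (single action a, so a path
-- is a sequence of states). A maximal path is either infinite, or finite
-- ending in a state without successors. `len = just m` means the path is
-- s₀ … s_m; `len = nothing` means it is infinite. Entries of `seq` beyond
-- the last index are irrelevant.

InDom : Maybe ℕ → ℕ → Set
InDom nothing  i = ⊤
InDom (just m) i = i ≤ m

record MaxPath (G : Topology) (v : Fin (n G)) : Set where
  field
    seq     : ℕ → Fin (n G)
    len     : Maybe ℕ
    start   : seq 0 ≡ v
    steps   : ∀ i → InDom len (suc i) → Edge G (seq i) (seq (suc i))
    maximal : ∀ m → len ≡ just m → ∀ w → ¬ Edge G (seq m) w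

open MaxPath public

mutual
  data StateF (k : ℕ) : Set where
    atom  : Fin k → StateF k
    tt    : StateF k
    ¬s_   : StateF k → StateF k
    _∧s_  : StateF k → StateF k → StateF k
    Ex    : PathF k → StateF k

  data PathF (k : ℕ) : Set where
    state : StateF k → PathF k
    ¬p_   : PathF k → PathF k
    _∧p_  : PathF k → PathF k → PathF k
    _U_   : PathF k → PathF k → PathF k

open import Data.Nat using (_⊔_)

mutual
  sdepth : ∀ {k} → StateF k → ℕ
  sdepth (atom _)  = 0
  sdepth tt        = 0
  sdepth (¬s φ)    = sdepth φ
  sdepth (φ ∧s ψ)  = sdepth φ ⊔ sdepth ψ
  sdepth (Ex φ)    = suc (pdepth φ)

  pdepth : ∀ {k} → PathF k → ℕ
  pdepth (state φ) = sdepth φ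
  pdepth (¬p φ)    = pdepth φ
  pdepth (φ ∧p ψ)  = pdepth φ ⊔ pdepth ψ
  pdepth (φ U ψ)   = pdepth φ ⊔ pdepth ψ

-- Semantics in T(G, ḡ): Λ(v) = {i} if v = g_i, ∅ otherwise.

mutual
  ssat : ∀ {k} (I : Instance k) → Fin (n (G I)) → StateF k → Set
  ssat I v (atom i) = v ≡ g I i
  ssat I v tt       = ⊤
  ssat I v (¬s φ)   = ¬ ssat I v φ
  ssat I v (φ ∧s ψ) = ssat I v φ × ssat I v ψ
  ssat I v (Ex φ)   = Σ (MaxPath (G I) v) λ π → psat I π 0 φ

  psat : ∀ {k} (I : Instance k) {v : Fin (n (G I))} →
         MaxPath (G I) v → ℕ → PathF k → Set
  psat I π i (state φ) = ssat I (seq π i) φ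
  psat I π i (¬p φ)    = ¬ psat I π i φ
  psat I π i (φ ∧p ψ)  = psat I π i φ × psat I π i ψ
  psat I π i (φ U ψ)   =
    Σ ℕ λ j → i ≤ j × InDom (len π) j × psat I π j ψ ×
      (∀ l → i ≤ l → l < j → psat I π l φ)

_⊨_ : ∀ {k} → Instance k → StateF k → Set
I ⊨ φ = ssat I (x (G I)) φ

CTLEquiv : ∀ {k} → ℕ → Instance k → Instance k → Set
CTLEquiv d I J = ∀ (φ : StateF _) → sdepth φ ≤ d →
  ((I ⊨ φ) → (J ⊨ φ)) × ((J ⊨ φ) → (I ⊨ φ))

FinitelyManyClasses : ∀ {k} → (Instance k → Instance k → Set) → Set
FinitelyManyClasses {k} R =
  Σ (List (Instance k)) λ reps → ∀ (I : Instance k) → Any (R I) reps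

{-# OPTIONS --safe #-}

-- Call a vertex blank if it is none of the g_i.  Between two visits to the g_i a path only meets
-- blank vertices.  Code the depth-0 type of a vertex by its label, and its depth-(e+1) type by
-- its depth-e type together with the set of pairs (w, x) such that some path from it runs through
-- blank vertices with stutter-free sequence w of depth-e codes, and then moves to g_i (x = just i)
-- or stays among the blank vertices, with constant code, forever (x = nothing).  Codes descend
-- along blank vertices for a lexicographic inclusion order, so the words w have no repetitions,
-- and for each e there is an explicit finite set of codes.
--
-- The codes of a vertex and of the g_i determine its CTL*_d\X theory: an assignment of truth
-- values to path formulas does not change along a stutter step, so a tableau for E φ can be run on
-- the words w, and satisfiability of E φ is a Büchi condition on a finite graph whose nodes are
-- exits with a truth assignment.  That condition is decidable, so the search for an accepting run
-- inside a given path may be carried out classically, under double negation.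
--
-- Representatives of bounded size are obtained by identifying vertices with equal depth-d codes.
-- This preserves the code at every depth e ≤ d: a path of the quotient is lifted from its end
-- backwards, using that equal codes at depth e+1 give the same complete words of depth-e codes.
module Submission where

open import Defs

open import Data.Bool using (Bool; true; false; T; not; _∧_; _∨_; if_then_else_)
import Data.Bool.Properties as Bool
open import Data.Empty using (⊥; ⊥-elim)
open import Data.Fin using (Fin; zero; suc; combine; remQuot; finToFun; funToFin; toℕ)
import Data.Fin.Properties as Fin
open import Data.List using (List; []; _∷_; _++_; map; length; lookup; allFin; cartesianProduct; cartesianProductWith; concatMap)
open import Data.List.Membership.Propositional using (_∈_; lose; find)
open import Data.List.Membership.Propositional.Properties using (∈-allFin; ∈-map⁺; ∈-cartesianProduct⁺; ∈-cartesianProductWith⁺; ∈-lookup)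
open import Data.List.Properties using (map-∘; map-id; length-map)
open import Data.List.Relation.Unary.All as All using (All; []; _∷_)
import Data.List.Relation.Unary.All.Properties as All
open import Data.List.Relation.Unary.AllPairs using ([]; _∷_)
open import Data.List.Relation.Unary.Any as Any using (Any; here; there)
import Data.List.Relation.Unary.Any.Properties as Any
open import Data.List.Relation.Unary.Unique.Propositional using (Unique)
open import Data.Maybe using (Maybe; just; nothing)
import Data.Maybe.Properties as Maybe
open import Data.Nat using (ℕ; zero; suc; _+_; _*_; _^_; _⊓_; _⊔_; _≤_; _<_; z≤n; s≤s; _≤?_)
open import Data.Nat.Properties hiding (_≟_)
open import Data.Product using (Σ; ∃; ∃₂; _×_; _,_; proj₁; proj₂)
open import Data.Product.Properties using (≡-dec)
open import Data.Sum using (_⊎_; inj₁; inj₂)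
open import Data.Unit using (⊤; tt)
open import Function using (_∘_; _⇔_; mk⇔; Equivalence)
open import Function.Construct.Identity using (⇔-id)
open import Function.Definitions using (Injective)
open import Level using (0ℓ)
open import Relation.Binary using (Rel; DecidableEquality) renaming (Decidable to Decidable₂)
open import Relation.Binary.Construct.Closure.ReflexiveTransitive using (Star; ε; _◅_; _◅◅_; gmap)
open import Relation.Binary.PropositionalEquality using (_≡_; _≢_; refl; sym; trans; cong; cong₂; subst; subst₂; module ≡-Reasoning)
open import Relation.Nullary using (¬_; Dec; yes; no; contradiction)
open import Relation.Nullary.Decidable using (map′; _×-dec_; _⊎-dec_; _→-dec_; ¬?; isYes; isYes≗does; dec-true; dec-false; toWitness; fromWitness; ¬¬-excluded-middle; decidable-stable)
open import Relation.Unary using (Decidable)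
open Equivalence using (to; from)

-- Finite types

Finite : Set → Set
Finite A = Σ (List A) λ xs → ∀ a → a ∈ xs

module _ {A : Set} (fin : Finite A) where

  ∃? : {P : A → Set} → Decidable P → Dec (∃ P)
  ∃? P? = map′ (λ p → let a , _ , pa = find p in a , pa)
               (λ (a , pa) → lose (proj₂ fin a) pa)
               (Any.any? P? (proj₁ fin))

finite-Fin : ∀ {n} → Finite (Fin n)
finite-Fin = allFin _ , ∈-allFin

finite-Bool : Finite Bool
finite-Bool = true ∷ false ∷ [] , λ { true → here refl ; false → there (here refl) }

finite-⊤ : Finite ⊤
finite-⊤ = _ ∷ [] , λ _ → here refl

finite-× : {A B : Set} → Finite A → Finite B → Finite (A × B)
finite-× (xs , ∈xs) (ys , ∈ys) =
  cartesianProduct xs ys , λ (a , b) → ∈-cartesianProduct⁺ (∈xs a) (∈ys b)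

finite-Maybe : {A : Set} → Finite A → Finite (Maybe A)
finite-Maybe (xs , ∈xs) =
  nothing ∷ map just xs , λ { nothing → here refl ; (just a) → there (∈-map⁺ just (∈xs a)) }

-- Warshall's algorithm.
module _ {A : Set} {R : Rel A 0ℓ} where

  Via : List A → A → A → Set
  Via []       a b = a ≡ b ⊎ R a b
  Via (x ∷ xs) a b = Via xs a b ⊎ (Via xs a x × Via xs x b)

  Via⇒Star : ∀ xs {a b} → Via xs a b → Star R a b
  Via⇒Star []       (inj₁ refl)    = ε
  Via⇒Star []       (inj₂ r)       = r ◅ ε
  Via⇒Star (x ∷ xs) (inj₁ p)       = Via⇒Star xs p
  Via⇒Star (x ∷ xs) (inj₂ (p , q)) = Via⇒Star xs p ◅◅ Via⇒Star xs q

  Via-base : ∀ xs {a b} → a ≡ b ⊎ R a b → Via xs a b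
  Via-base []       p = p
  Via-base (x ∷ xs) p = inj₁ (Via-base xs p)

  -- Two passages through `x` are cut down to one: only the part before the first and the part after
  -- the second is kept, so the composite uses each pivot at most once.
  Via-trans : ∀ xs {a y b} → y ∈ xs → Via xs a y → Via xs y b → Via xs a b
  Via-trans (x ∷ xs) (here refl) p q = inj₂ (towards p , away q)
    where
    towards : ∀ {a} → Via (x ∷ xs) a x → Via xs a x
    towards (inj₁ p)       = p
    towards (inj₂ (p , _)) = p
    away : ∀ {b} → Via (x ∷ xs) x b → Via xs x b
    away (inj₁ p)       = p
    away (inj₂ (_ , q)) = q
  Via-trans (x ∷ xs) (there y∈) (inj₁ p) (inj₁ q) = inj₁ (Via-trans xs y∈ p q)
  Via-trans (x ∷ xs) (there y∈) (inj₁ p) (inj₂ (q , r)) = inj₂ (Via-trans xs y∈ p q , r)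
  Via-trans (x ∷ xs) (there y∈) (inj₂ (p , q)) (inj₁ r) = inj₂ (p , Via-trans xs y∈ q r)
  Via-trans (x ∷ xs) (there y∈) (inj₂ (p , _)) (inj₂ (_ , r)) = inj₂ (p , r)

  star? : Finite A → DecidableEquality A → Decidable₂ R → Decidable₂ (Star R)
  star? (xs , ∈xs) _≟_ R? a b = map′ (Via⇒Star xs) Star⇒Via (via? xs a b)
    where
    via? : ∀ ys → Decidable₂ (Via ys)
    via? []       a b = (a ≟ b) ⊎-dec R? a b
    via? (y ∷ ys) a b = via? ys a b ⊎-dec (via? ys a y ×-dec via? ys y b)
    Star⇒Via : ∀ {a b} → Star R a b → Via xs a b
    Star⇒Via ε       = Via-base xs (inj₁ refl)
    Star⇒Via (r ◅ p) = Via-trans xs (∈xs _) (Via-base xs (inj₂ r)) (Star⇒Via p)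

-- Codes and acceptance

words : {A : Set} → List A → ℕ → List (List A)
words as zero    = [] ∷ []
words as (suc l) = [] ∷ cartesianProductWith _∷_ as (words as l)

∈-words : {A : Set} {as : List A} → (∀ a → a ∈ as) → ∀ {l} ws → length ws ≤ l → ws ∈ words as l
∈-words ∈as {zero}  []       _         = here refl
∈-words ∈as {suc l} []       _         = here refl
∈-words ∈as {suc l} (w ∷ ws) (s≤s len) =
  there (∈-cartesianProductWith⁺ _∷_ (∈as w) (∈-words ∈as ws len))

-- `merge` collapses a repeated letter and `split` inserts one, so runs along vertices can be
-- compared with runs on stutter-free words. `Final` is the condition for reading one letter
-- forever.
record Automaton (C : Set) : Set₁ where
  field
    State   : Set
    finite  : Finite State
    _≟_     : DecidableEquality State
    Next    : C → State → State → Set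
    next?   : ∀ c → Decidable₂ (Next c)
    merge   : ∀ {c p q r} → Next c p q → Next c q r → Next c p r
    split   : ∀ {c p r} → Next c p r → ∃ λ q → Next c p q × Next c q r
    Final   : C → State → Set
    final?  : ∀ c q → Dec (Final c q)

module Codes (k : ℕ) where

  Exit : Set
  Exit = Maybe (Fin k)

  exits : Finite Exit
  exits = finite-Maybe finite-Fin

  _≟ˣ_ : DecidableEquality Exit
  _≟ˣ_ = Maybe.≡-dec Fin._≟_

  -- Words of length at most `m` suffice, since the recorded words have no repeated letter
  -- (`Seg-unique`).
  items : ∀ m → List (List (Fin m) × Exit)
  items m = cartesianProduct (words (allFin m) m) (proj₁ exits)

  #codes : ℕ → ℕ
  #codes zero    = suc k
  #codes (suc e) = #codes e * 2 ^ length (items (#codes e))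

  -- The wrapper lets unification recover `e`, which `Fin (#codes e)` alone would not.
  record Code (e : ℕ) : Set where
    constructor ⟨_⟩
    field index : Fin (#codes e)

  open Code

  infix 4 _≟ᶜ_
  _≟ᶜ_ : ∀ {e} → DecidableEquality (Code e)
  c ≟ᶜ c′ = map′ (cong ⟨_⟩) (cong index) (index c Fin.≟ index c′)

  Item : ℕ → Set
  Item e = Fin (length (items (#codes e)))

  item : ∀ e → Item e → List (Code e) × Exit
  item e i = map ⟨_⟩ (proj₁ (lookup (items (#codes e)) i)) , proj₂ (lookup (items (#codes e)) i)

  item-surjective : ∀ {e} (ws : List (Code e)) x → length ws ≤ #codes e → ∃ λ i → item e i ≡ (ws , x)
  item-surjective {e} ws x len =
    Any.index ∈items ,
    trans (cong (λ (ws , x) → map ⟨_⟩ ws , x) (sym (Any.lookup-index ∈items)))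
          (cong (_, x) (trans (sym (map-∘ ws)) (map-id ws)))
    where
    ∈items : (map index ws , x) ∈ items (#codes e)
    ∈items = ∈-cartesianProduct⁺
      (∈-words ∈-allFin (map index ws) (subst (_≤ #codes e) (sym (length-map index ws)) len))
      (proj₂ exits x)

  pr : ∀ {e} → Code (suc e) → Code e
  pr {e} c = ⟨ proj₁ (remQuot {#codes e} _ (index c)) ⟩

  bit : ∀ {e} → Code (suc e) → Item e → Fin 2
  bit {e} c = finToFun (proj₂ (remQuot {#codes e} _ (index c)))

  toBit : Bool → Fin 2
  toBit b = if b then suc zero else zero

  mkCode : ∀ {e} → Code e → (Item e → Bool) → Code (suc e)
  mkCode c f = ⟨ combine (index c) (funToFin (toBit ∘ f)) ⟩

  pr-mkCode : ∀ {e} (c : Code e) f → pr (mkCode c f) ≡ c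
  pr-mkCode c f = cong (⟨_⟩ ∘ proj₁) (Fin.remQuot-combine (index c) _)

  bit-mkCode : ∀ {e} (c : Code e) f i → bit (mkCode c f) i ≡ toBit (f i)
  bit-mkCode c f i =
    trans (cong (λ p → finToFun (proj₂ p) i) (Fin.remQuot-combine (index c) (funToFin (toBit ∘ f))))
          (Fin.finToFun-funToFin _ i)

  funToFin-cong : ∀ {m l} {f f′ : Fin m → Fin l} → (∀ i → f i ≡ f′ i) → funToFin f ≡ funToFin f′
  funToFin-cong {zero}  _  = refl
  funToFin-cong {suc m} eq = cong₂ combine (eq zero) (funToFin-cong (eq ∘ suc))

  code-ext : ∀ {e} {c c′ : Code (suc e)} → pr c ≡ pr c′ → (∀ i → bit c i ≡ bit c′ i) → c ≡ c′
  code-ext {e} {c} {c′} p≡ b≡ = cong ⟨_⟩ (begin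
    index c                                     ≡⟨ rebuild c ⟩
    combine (index (pr c)) (funToFin (bit c))   ≡⟨ cong₂ combine (cong index p≡) (funToFin-cong b≡) ⟩
    combine (index (pr c′)) (funToFin (bit c′)) ≡⟨ rebuild c′ ⟨
    index c′                                    ∎)
    where
    open ≡-Reasoning
    rebuild : (c : Code (suc e)) → index c ≡ combine (index (pr c)) (funToFin (bit c))
    rebuild c = trans (sym (Fin.combine-remQuot {#codes e} _ (index c)))
                      (cong (combine (index (pr c))) (sym (Fin.funToFin-finToFin {length (items (#codes e))} _)))

  label : ∀ {e} → Code e → Fin (suc k)
  label {zero}  c = index c
  label {suc e} c = label (pr c)

  Lang : ∀ {e} → Code (suc e) → List (Code e) → Exit → Set
  Lang {e} c ws x = ∃ λ i → item e i ≡ (ws , x) × bit c i ≡ suc zero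

  infix 4 _≼_
  -- Lexicographic: first the lower code, then inclusion of the recorded sets, compared only when
  -- the lower codes are equal. At depth 0 blank lies below everything, as a blank vertex may follow
  -- any vertex.
  data _≼_ : ∀ {e} → Code e → Code e → Set where
    blank : {c c′ : Code zero} → index c ≡ zero → c ≼ c′
    equal : {c c′ : Code zero} → c ≡ c′ → c ≼ c′
    lex   : ∀ {e} {c c′ : Code (suc e)} → pr c ≼ pr c′ →
            (pr c ≡ pr c′ → ∀ i → bit c i ≡ suc zero → bit c′ i ≡ suc zero) → c ≼ c′

  ≼-refl : ∀ {e} {c : Code e} → c ≼ c
  ≼-refl {zero}  = equal refl
  ≼-refl {suc e} = lex ≼-refl λ _ _ b → b

  ≼-antisym : ∀ {e} {c c′ : Code e} → c ≼ c′ → c′ ≼ c → c ≡ c′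
  ≼-antisym (equal eq) _          = eq
  ≼-antisym (blank eq) (blank eq′) = cong ⟨_⟩ (trans eq (sym eq′))
  ≼-antisym (blank _)  (equal eq) = sym eq
  ≼-antisym (lex p f) (lex p′ f′) =
    code-ext pr≡ λ i → bits (f pr≡ i) (f′ (sym pr≡) i)
    where
    pr≡ = ≼-antisym p p′
    bits : {a b : Fin 2} → (a ≡ suc zero → b ≡ suc zero) → (b ≡ suc zero → a ≡ suc zero) → a ≡ b
    bits {zero}     {zero}     _ _ = refl
    bits {zero}     {suc zero} _ h = h refl
    bits {suc zero} {b}        h _ = sym (h refl)

  ≼-trans : ∀ {e} {a b c : Code e} → a ≼ b → b ≼ c → a ≼ c
  ≼-trans (blank eq)   _          = blank eq
  ≼-trans (equal refl) b≼c        = b≼c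
  ≼-trans {suc e} {a} {b} {c} (lex p f) (lex p′ f′) = lex (≼-trans p p′) λ pra≡prc i h →
    -- When the outer lower codes are equal, antisymmetry squeezes the middle one, so both
    -- inclusions apply.
    let prb≡pra = ≼-antisym (subst (pr b ≼_) (sym pra≡prc) p′) p
    in f′ (trans prb≡pra pra≡prc) i (f (sym prb≡pra) i h)

  -- Automata read segment by segment.

  module Macro {e} (𝔸 : Automaton (Code e)) (γ : Fin k → Code (suc e)) where
    open Automaton 𝔸

    -- With exit `nothing` the last letter is read forever, which calls for `Final`.
    Last : Exit → Code e → State → State → Set
    Last (just _) c p q = Next c p q
    Last nothing  c p q = Next c p q × Final c q

    last? : ∀ x c p q → Dec (Last x c p q)
    last? (just _) c p q = next? c p q
    last? nothing  c p q = next? c p q ×-dec final? c q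

    Run : Exit → List (Code e) → State → State → Set
    Run x []       p q = ⊥
    Run x (c ∷ ws) p q = (ws ≡ [] × Last x c p q) ⊎ ∃ λ r → Next c p r × Run x ws r q

    run? : ∀ x ws p q → Dec (Run x ws p q)
    run? x []       p q = no λ ()
    run? x (c ∷ ws) p q =
      (empty? ws ×-dec last? x c p q) ⊎-dec ∃? finite (λ r → next? c p r ×-dec run? x ws r q)
      where
      empty? : ∀ ws → Dec (ws ≡ [])
      empty? []      = yes refl
      empty? (_ ∷ _) = no λ ()

    Node : Set
    Node = Exit × State

    First : Code (suc e) → State → Node → Set
    First c p (x , q) = ∃ λ ws → Lang c ws x × Run x ws p q

    first? : ∀ c p s → Dec (First c p s)
    first? c p (x , q) = map′ decode encode
      (∃? finite-Fin λ i → bit c i Fin.≟ suc zero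
                     ×-dec (proj₂ (item e i) ≟ˣ x ×-dec run? x (proj₁ (item e i)) p q))
      where
      decode : _ → First c p (x , q)
      decode (i , b , refl , r) = proj₁ (item e i) , (i , refl , b) , r
      encode : First c p (x , q) → _
      encode (ws , (i , eq , b) , r) =
        i , b , cong proj₂ eq , subst (λ ws → Run x ws p q) (sym (cong proj₁ eq)) r

    _⟶_ : Node → Node → Set
    (just i  , p) ⟶ s = First (γ i) p s
    (nothing , p) ⟶ s = ⊥

    _⟶?_ : Decidable₂ _⟶_
    (just i  , p) ⟶? s = first? (γ i) p s
    (nothing , p) ⟶? s = no λ ()

    Reach : Code (suc e) → State → Node → Set
    Reach c p s = ∃ λ t → First c p t × Star _⟶_ t s

    reach? : ∀ c p s → Dec (Reach c p s)
    reach? c p s = ∃? (finite-× exits finite) λ t →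
      first? c p t ×-dec star? (finite-× exits finite) (≡-dec _≟ˣ_ _≟_) _⟶?_ t s

  -- Only untils need a guessed bit; the value of any other subformula is computed from the letter
  -- and the bits below it.
  Truth : PathF k → Set
  Truth (state s) = ⊤
  Truth (¬p φ)    = Truth φ
  Truth (φ ∧p ψ)  = Truth φ × Truth ψ
  Truth (φ U ψ)   = Bool × Truth φ × Truth ψ

  finite-Truth : ∀ φ → Finite (Truth φ)
  finite-Truth (state s) = finite-⊤
  finite-Truth (¬p φ)    = finite-Truth φ
  finite-Truth (φ ∧p ψ)  = finite-× (finite-Truth φ) (finite-Truth ψ)
  finite-Truth (φ U ψ)   = finite-× finite-Bool (finite-× (finite-Truth φ) (finite-Truth ψ))

  truth-≟ : ∀ φ → DecidableEquality (Truth φ)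
  truth-≟ (state s) _ _ = yes refl
  truth-≟ (¬p φ)        = truth-≟ φ
  truth-≟ (φ ∧p ψ)      = ≡-dec (truth-≟ φ) (truth-≟ ψ)
  truth-≟ (φ U ψ)       = ≡-dec Bool._≟_ (≡-dec (truth-≟ φ) (truth-≟ ψ))

  -- The tableau of a path formula.

  module Tableau {C : Set} (val : C → StateF k → Bool) where

    eval : ∀ φ → C → Truth φ → Bool
    eval (state s) c _           = val c s
    eval (¬p φ)    c t           = not (eval φ c t)
    eval (φ ∧p ψ)  c (t , u)     = eval φ c t ∧ eval ψ c u
    eval (φ U ψ)   c (b , _)     = b

    -- The expansion law of until, with `b` its value one letter later.
    unfold : Bool → Bool → Bool → Bool
    unfold b₁ b₂ b = b₂ ∨ (b₁ ∧ b)

    Next : ∀ φ → C → Truth φ → Truth φ → Set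
    Next (state s) c _ _ = ⊤
    Next (¬p φ)    c t t′ = Next φ c t t′
    Next (φ ∧p ψ)  c (t , u) (t′ , u′) = Next φ c t t′ × Next ψ c u u′
    Next (φ U ψ)   c (b , t , u) (b′ , t′ , u′) =
      b ≡ unfold (eval φ c t) (eval ψ c u) b′ × Next φ c t t′ × Next ψ c u u′

    next? : ∀ φ c → Decidable₂ (Next φ c)
    next? (state s) c _ _ = yes tt
    next? (¬p φ)    c t t′ = next? φ c t t′
    next? (φ ∧p ψ)  c (t , u) (t′ , u′) = next? φ c t t′ ×-dec next? ψ c u u′
    next? (φ U ψ)   c (b , t , u) (b′ , t′ , u′) =
      b Bool.≟ _ ×-dec (next? φ c t t′ ×-dec next? ψ c u u′)

    -- A repeated letter does not change the truth assignment, as there is no next-time operator.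
    next-stutter : ∀ φ {c t t′ t″} → Next φ c t t′ → Next φ c t′ t″ → t ≡ t′
    next-stutter (state s) _ _ = refl
    next-stutter (¬p φ) p q = next-stutter φ p q
    next-stutter (φ ∧p ψ) (p , p′) (q , q′) = cong₂ _,_ (next-stutter φ p q) (next-stutter ψ p′ q′)
    next-stutter (φ U ψ) {c} {_ , t , u} {_ , _ , _} {b , _} (eq , p , p′) (eq′ , q , q′)
      with refl ← next-stutter φ p q | refl ← next-stutter ψ p′ q′ =
      cong (_, _) (trans eq (trans (cong (unfold b₁ b₂) eq′) (trans (absorb b₁ b₂) (sym eq′))))
      where
      b₁ = eval φ c t
      b₂ = eval ψ c u
      absorb : ∀ b₁ b₂ → unfold b₁ b₂ (unfold b₁ b₂ b) ≡ unfold b₁ b₂ b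
      absorb false false = refl
      absorb true  false = refl
      absorb false true  = refl
      absorb true  true  = refl

    -- The expansion law with a fixed letter is idempotent, so the assignment before a step may be
    -- kept for one more reading of that letter. This provides `split`.
    next-refl : ∀ φ {c t t′} → Next φ c t t′ → Next φ c t t
    next-refl (state s) p = tt
    next-refl (¬p φ) p = next-refl φ p
    next-refl (φ ∧p ψ) (p , q) = next-refl φ p , next-refl ψ q
    next-refl (φ U ψ) {c} {_ , t , u} {b , _} (refl , p , q) =
      fixed (eval φ c t) (eval ψ c u) , next-refl φ p , next-refl ψ q
      where
      fixed : ∀ b₁ b₂ → unfold b₁ b₂ b ≡ unfold b₁ b₂ (unfold b₁ b₂ b)
      fixed false false = refl
      fixed true  false = refl
      fixed false true  = refl
      fixed true  true  = refl

    Test : PathF k → Set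
    Test φ = C → Truth φ → Bool

    -- The Büchi condition: each until is infinitely often false or fulfilled.
    fulfilments : ∀ φ → List (Test φ)
    fulfilments (state s) = []
    fulfilments (¬p φ)    = fulfilments φ
    fulfilments (φ ∧p ψ)  = map (λ f c (t , _) → f c t) (fulfilments φ)
                         ++ map (λ f c (_ , u) → f c u) (fulfilments ψ)
    fulfilments (φ U ψ)   = (λ c (b , _ , u) → not b ∨ eval ψ c u)
                          ∷ map (λ f c (_ , t , _) → f c t) (fulfilments φ)
                         ++ map (λ f c (_ , _ , u) → f c u) (fulfilments ψ)

    automaton : PathF k → Automaton C
    automaton φ = record
      { State  = Truth φ
      ; finite = finite-Truth φ
      ; _≟_    = truth-≟ φ
      ; Next   = Next φ
      ; next?  = next? φ
      ; merge  = λ {c} {p} {q} {r} m n → subst (λ q → Next φ c q r) (sym (next-stutter φ m n)) n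
      ; split  = λ m → _ , next-refl φ m , m
      ; Final  = λ c t → Next φ c t t × All (λ f → T (f c t)) (fulfilments φ)
      ; final? = λ c t → next? φ c t t ×-dec All.all? (λ f → Bool.T? (f c t)) (fulfilments φ)
      }

    -- The additional bit records whether the test has succeeded so far.
    monitor : ∀ φ → Test φ → Automaton C
    monitor φ f = record
      { State  = Truth φ × Bool
      ; finite = finite-× (finite-Truth φ) finite-Bool
      ; _≟_    = ≡-dec (truth-≟ φ) Bool._≟_
      ; Next   = λ c (t , b) (t′ , b′) → Next φ c t t′ × b′ ≡ b ∨ f c t
      ; next?  = λ c (t , b) (t′ , b′) → next? φ c t t′ ×-dec b′ Bool.≟ _
      ; merge  = merge
      ; split  = λ { {c} {t , b} (m , refl) → (t , b ∨ f c t) , (next-refl φ m , refl) ,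
                     m , absorb b (f c t) }
      -- The monitor serves only returns to a marked vertex, never a stay among blank ones.
      ; Final  = λ _ _ → ⊥
      ; final? = λ _ _ → no λ ()
      }
      where
      absorb : ∀ b b′ → b ∨ b′ ≡ (b ∨ b′) ∨ b′
      absorb false false = refl
      absorb true  false = refl
      absorb false true  = refl
      absorb true  true  = refl
      merge : ∀ {c} {p q r : Truth φ × Bool} →
              Next φ c (proj₁ p) (proj₁ q) × proj₂ q ≡ proj₂ p ∨ f c (proj₁ p) →
              Next φ c (proj₁ q) (proj₁ r) × proj₂ r ≡ proj₂ q ∨ f c (proj₁ q) →
              Next φ c (proj₁ p) (proj₁ r) × proj₂ r ≡ proj₂ p ∨ f c (proj₁ p)
      merge {c} {t , b} (m , refl) (m′ , refl) with refl ← next-stutter φ m m′ =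
        m′ , sym (absorb b (f c t))

  -- The Büchi condition on the graph of nodes.

  module Acceptance {e} (val : Code e → StateF k → Bool) (γ : Fin k → Code (suc e)) (φ : PathF k) where
    open Tableau val public
    module Main = Macro {e} (automaton φ) γ
    module Monitor (f : Test φ) = Macro {e} (monitor φ f) γ

    -- The constant test makes a recurrence nonempty when φ has no until.
    tests : List (Test φ)
    tests = (λ _ _ → true) ∷ fulfilments φ

    -- A separate cycle for each test suffices, as cycles through one node can be traversed in turn.
    -- For `nothing` the condition is already part of `Final`.
    Recurrent : Main.Node → Set
    Recurrent (nothing , t) = ⊤
    Recurrent (just i  , t) =
      All (λ f → Monitor.Reach f (γ i) (t , false) (just i , t , true)) tests

    recurrent? : ∀ s → Dec (Recurrent s)
    recurrent? (nothing , t) = yes tt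
    recurrent? (just i  , t) = All.all? (λ f → Monitor.reach? f (γ i) _ _) tests

    Accepts : Code (suc e) → Set
    Accepts c = ∃ λ t → T (eval φ (pr {e} c) t) × ∃ λ s → Main.Reach c t s × Recurrent s

    accepts? : ∀ c → Dec (Accepts c)
    accepts? c = ∃? (finite-Truth φ) λ t → Bool.T? _ ×-dec
      ∃? (finite-× exits (finite-Truth φ)) λ s → Main.reach? c t s ×-dec recurrent? s

  sat : ∀ e → (Fin k → Code e) → Code e → StateF k → Bool
  sat e       γ c (atom i)  = isYes (label c Fin.≟ suc i)
  sat e       γ c tt        = true
  sat e       γ c (¬s s)    = not (sat e γ c s)
  sat e       γ c (s ∧s s′) = sat e γ c s ∧ sat e γ c s′
  -- A default value outside the depth bound assumed in `sat-correct`.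
  sat zero    γ c (Ex φ)    = false
  sat (suc e) γ c (Ex φ)    = isYes (Acceptance.accepts? {e} (sat e (pr {e} ∘ γ)) γ φ c)

-- Segments of an instance

lookup-injective : {A : Set} {xs : List A} → Unique xs → ∀ {i j} → lookup xs i ≡ lookup xs j → i ≡ j
lookup-injective (_ ∷ _)  {zero}  {zero}  _  = refl
lookup-injective (x∉ ∷ _) {zero}  {suc j} eq = contradiction eq (All.lookup x∉ (∈-lookup j))
lookup-injective (x∉ ∷ _) {suc i} {zero}  eq = contradiction (sym eq) (All.lookup x∉ (∈-lookup i))
lookup-injective (_ ∷ u)  {suc i} {suc j} eq = cong suc (lookup-injective u eq)

module System {k} (I : Instance k) where
  open Codes k

  V : Set
  V = Fin (n (G I))

  Dead : V → Set
  Dead v = ∀ w → ¬ Edge (G I) v w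

  dead? : ∀ v → Dec (Dead v)
  dead? v = Fin.all? λ w → ¬? (Bool.T? (E (G I) v w))

  -- A finite maximal path is identified with the infinite one that repeats its last vertex.
  Step : V → V → Set
  Step v w = Edge (G I) v w ⊎ (v ≡ w × Dead v)

  step? : Decidable₂ Step
  step? v w = Bool.T? (E (G I) v w) ⊎-dec (v Fin.≟ w ×-dec dead? v)

  lab : V → Fin (suc k)
  lab v with Fin.any? (λ i → v Fin.≟ g I i)
  ... | yes (i , _) = suc i
  ... | no _        = zero

  lab-g : ∀ i → lab (g I i) ≡ suc i
  lab-g i with Fin.any? (λ j → g I i Fin.≟ g I j)
  ... | yes (j , eq) = cong suc (sym (distinct I eq))
  ... | no none      = contradiction (i , refl) none

  lab-suc : ∀ {v i} → lab v ≡ suc i → v ≡ g I i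
  lab-suc {v} eq with Fin.any? (λ j → v Fin.≟ g I j) | eq
  ... | yes (_ , v≡) | refl = v≡

  Blank : V → Set
  Blank v = lab v ≡ zero

  ¬blank-g : ∀ {i} → ¬ Blank (g I i)
  ¬blank-g {i} b with () ← trans (sym (lab-g i)) b

  blank-or-g : ∀ v → Blank v ⊎ ∃ λ i → v ≡ g I i
  blank-or-g v with lab v in eq
  ... | zero  = inj₁ refl
  ... | suc i = inj₂ (i , lab-suc eq)

  BlankStep : V → V → Set
  BlankStep v w = Step v w × Blank w

  blankStep? : Decidable₂ BlankStep
  blankStep? v w = step? v w ×-dec lab w Fin.≟ zero

  -- In a finite graph, staying among blank vertices forever amounts to reaching a blank cycle.
  -- Codes descend around it and return, so they are constant on it.
  Loop : V → Set
  Loop v = ∃ λ w → BlankStep v w × Star BlankStep w v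

  loop? : ∀ v → Dec (Loop v)
  loop? v = ∃? finite-Fin λ w → blankStep? v w ×-dec star? finite-Fin Fin._≟_ blankStep? w v

  blank-target : ∀ {v w} → Blank v → Star BlankStep v w → Blank w
  blank-target b ε = b
  blank-target b ((_ , b′) ◅ p) = blank-target b′ p

  loop-blank : ∀ {v} → Loop v → Blank v
  loop-blank (w , (_ , b) , p) = blank-target b p

  Leaves : V → Exit → Set
  Leaves v (just i) = Step v (g I i)
  Leaves v nothing  = Loop v

  leaves? : ∀ v x → Dec (Leaves v x)
  leaves? v (just i) = step? v (g I i)
  leaves? v nothing  = loop? v

  module Segments {e} (c : V → Code e) where

    -- The first vertex may be marked, all later ones are blank. A step that keeps the code adds no
    -- letter.
    data Seg (v : V) : List (Code e) → Exit → Set where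
      leave   : ∀ {x} → Leaves v x → Seg v (c v ∷ []) x
      stutter : ∀ {w ws x} → Step v w → Blank w → c w ≡ c v → Seg w ws x → Seg v ws x
      move    : ∀ {w ws x} → Step v w → Blank w → c w ≢ c v → Seg w ws x → Seg v (c v ∷ ws) x

    Stutter : V → V → Set
    Stutter v w = BlankStep v w × c w ≡ c v

    -- A form of `Seg` by recursion on the word: each letter becomes a reachability question in a
    -- finite graph, hence decidable.
    SegList : V → List (Code e) → Exit → Set
    SegList v []       x = ⊥
    SegList v (a ∷ ws) x = ∃ λ u → Star Stutter v u × c u ≡ a ×
      ((ws ≡ [] × Leaves u x) ⊎ ∃ λ w → BlankStep u w × c w ≢ c u × SegList w ws x)

    segList? : ∀ v ws x → Dec (SegList v ws x)
    segList? v []       x = no λ ()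
    segList? v (a ∷ ws) x = ∃? finite-Fin λ u →
      star? finite-Fin Fin._≟_ (λ v w → blankStep? v w ×-dec c w ≟ᶜ c v) v u ×-dec (c u ≟ᶜ a ×-dec
      ((empty? ws ×-dec leaves? u x) ⊎-dec
       ∃? finite-Fin λ w → blankStep? u w ×-dec (¬? (c w ≟ᶜ c u) ×-dec segList? w ws x)))
      where
      empty? : ∀ ws → Dec (ws ≡ [])
      empty? []      = yes refl
      empty? (_ ∷ _) = no λ ()

    Seg⇒SegList : ∀ {v ws x} → Seg v ws x → SegList v ws x
    Seg⇒SegList (leave l) = _ , ε , refl , inj₁ (refl , l)
    Seg⇒SegList (move s b neq p) = _ , ε , refl , inj₂ (_ , (s , b) , neq , Seg⇒SegList p)
    Seg⇒SegList {ws = []} (stutter _ _ _ p) = ⊥-elim (Seg⇒SegList p)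
    Seg⇒SegList {ws = _ ∷ _} (stutter s b eq p) with u , st , rest ← Seg⇒SegList p =
      u , ((s , b) , eq) ◅ st , rest

    stutters : ∀ {v u ws x} → Star Stutter v u → Seg u ws x → Seg v ws x
    stutters ε p = p
    stutters (((s , b) , eq) ◅ st) p = stutter s b eq (stutters st p)

    SegList⇒Seg : ∀ {v} ws {x} → SegList v ws x → Seg v ws x
    SegList⇒Seg (_ ∷ _)  (u , st , refl , inj₁ (refl , l)) = stutters st (leave l)
    SegList⇒Seg (_ ∷ ws) (u , st , refl , inj₂ (w , (s , b) , neq , p)) =
      stutters st (move s b neq (SegList⇒Seg ws p))

    seg? : ∀ v ws x → Dec (Seg v ws x)
    seg? v ws x = map′ (SegList⇒Seg ws) Seg⇒SegList (segList? v ws x)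

  open Segments public

  code : ∀ e → V → Code e
  code zero    v = ⟨ lab v ⟩
  code (suc e) v = mkCode (code e v) λ i → isYes (seg? (code e) v (proj₁ (item e i)) (proj₂ (item e i)))

  pr-code : ∀ e v → pr (code (suc e) v) ≡ code e v
  pr-code e v = pr-mkCode _ _

  label-code : ∀ e v → label (code e v) ≡ lab v
  label-code zero    v = refl
  label-code (suc e) v = trans (cong label (pr-code e v)) (label-code e v)

  bit⇒Seg : ∀ e {v} i → bit (code (suc e) v) i ≡ suc zero →
            Seg (code e) v (proj₁ (item e i)) (proj₂ (item e i))
  bit⇒Seg e {v} i b
    with seg? (code e) v (proj₁ (item e i)) (proj₂ (item e i))
       | trans (sym b) (bit-mkCode (code e v) (λ i → isYes (seg? (code e) v (proj₁ (item e i)) (proj₂ (item e i)))) i)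
  ... | yes p | _ = p

  Seg⇒bit : ∀ e {v} i → Seg (code e) v (proj₁ (item e i)) (proj₂ (item e i)) →
            bit (code (suc e) v) i ≡ suc zero
  Seg⇒bit e {v} i p = trans (bit-mkCode (code e v) (λ i → isYes (seg? (code e) v (proj₁ (item e i)) (proj₂ (item e i)))) i)
    (cong toBit (trans (isYes≗does s?) (dec-true s? p)))
    where s? = seg? (code e) v (proj₁ (item e i)) (proj₂ (item e i))

  -- If the lower codes agree, a stuttering step turns every segment of `w` into one of `v` with the
  -- same word, so the recorded set can only shrink along the step.
  descend : ∀ e {v w} → Step v w → Blank w → code e w ≼ code e v
  descend zero    s b = blank b
  descend (suc e) {v} {w} s b =
    lex (prs (descend e s b)) λ eq i h → Seg⇒bit e i (stutter s b (unpr eq) (bit⇒Seg e i h))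
    where
    prs : code e w ≼ code e v → pr (code (suc e) w) ≼ pr (code (suc e) v)
    prs p rewrite pr-code e v | pr-code e w = p
    unpr : pr (code (suc e) w) ≡ pr (code (suc e) v) → code e w ≡ code e v
    unpr eq = trans (sym (pr-code e w)) (trans eq (pr-code e v))

  descends : ∀ e {v w} → Star BlankStep v w → code e w ≼ code e v
  descends e ε = ≼-refl
  descends e ((s , b) ◅ p) = ≼-trans (descends e p) (descend e s b)

  Seg-below : ∀ e {v ws x} → Seg (code e) v ws x → All (_≼ code e v) ws
  Seg-below e (leave l)          = ≼-refl ∷ []
  Seg-below e (stutter s b eq p) = All.map (λ q → ≼-trans q (descend e s b)) (Seg-below e p)
  Seg-below e (move s b neq p)     = ≼-refl ∷ All.map (λ q → ≼-trans q (descend e s b)) (Seg-below e p)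

  -- Each `move` descends strictly and later letters stay below its target, so the letter left
  -- behind cannot recur.
  Seg-unique : ∀ e {v ws x} → Seg (code e) v ws x → Unique ws
  Seg-unique e (leave l)          = [] ∷ []
  Seg-unique e (stutter s b eq p) = Seg-unique e p
  Seg-unique e (move s b neq p)     = All.map
    (λ q eq → neq (≼-antisym (descend e s b) (subst (_≼ _) (sym eq) q))) (Seg-below e p)
    ∷ Seg-unique e p

  Seg-length : ∀ e {v ws x} → Seg (code e) v ws x → length ws ≤ #codes e
  Seg-length e p = Fin.injective⇒≤ λ eq →
    lookup-injective (Seg-unique e p) (cong ⟨_⟩ eq)

  -- The length bound places every segment's word among the items, so the code misses no segment.
  Seg⇒Lang : ∀ e {v ws x} → Seg (code e) v ws x → Lang (code (suc e) v) ws x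
  Seg⇒Lang e {v} {ws} {x} p with i , eq ← item-surjective ws x (Seg-length e p) =
    i , eq , Seg⇒bit e i (subst (λ (ws , x) → Seg (code e) v ws x) (sym eq) p)

  Lang⇒Seg : ∀ e {v ws x} → Lang (code (suc e) v) ws x → Seg (code e) v ws x
  Lang⇒Seg e (i , refl , b) = bit⇒Seg e i b

-- Path formulas on infinite runs

module Omega {k : ℕ} (A : ℕ → StateF k → Set) where

  Holds : ℕ → PathF k → Set
  Holds i (state s) = A i s
  Holds i (¬p φ)    = ¬ Holds i φ
  Holds i (φ ∧p ψ)  = Holds i φ × Holds i ψ
  Holds i (φ U ψ)   = ∃ λ j → i ≤ j × Holds j ψ × (∀ l → i ≤ l → l < j → Holds l φ)

  U-now : ∀ {i φ ψ} → Holds i ψ → Holds i (φ U ψ)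
  U-now h = _ , ≤-refl , h , λ l i≤l l<i → contradiction (≤-<-trans i≤l l<i) (<-irrefl refl)

  U-later : ∀ {i φ ψ} → Holds i φ → Holds (suc i) (φ U ψ) → Holds i (φ U ψ)
  U-later {i} {φ} h (j , i<j , hψ , hφ) = j , <⇒≤ i<j , hψ , before
    where
    before : ∀ l → i ≤ l → l < j → Holds l φ
    before l i≤l l<j with m≤n⇒m<n∨m≡n i≤l
    ... | inj₁ i<l  = hφ l i<l l<j
    ... | inj₂ refl = h

  U-unfold : ∀ {i φ ψ} → Holds i (φ U ψ) → Holds i ψ ⊎ (Holds i φ × Holds (suc i) (φ U ψ))
  U-unfold (j , i≤j , hψ , hφ) with m≤n⇒m<n∨m≡n i≤j
  ... | inj₂ refl = inj₁ hψ
  ... | inj₁ i<j  = inj₂ (hφ _ ≤-refl i<j , j , i<j , hψ , λ l i<l → hφ l (<⇒≤ i<l))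

  -- On a constant tail an until is equivalent to its right-hand argument.
  constant : ∀ e {a} → (∀ i s → a ≤ i → sdepth s ≤ e → A i s ⇔ A a s) →
             ∀ φ → pdepth φ ≤ e → ∀ {i} → a ≤ i → Holds i φ ⇔ Holds a φ
  constant e A≡ (state s) d a≤i = A≡ _ s a≤i d
  constant e A≡ (¬p φ) d a≤i = mk⇔ (_∘ from eq) (_∘ to eq)
    where eq = constant e A≡ φ d a≤i
  constant e A≡ (φ ∧p ψ) d a≤i = mk⇔ (λ (h , h′) → to eq h , to eq′ h′) (λ (h , h′) → from eq h , from eq′ h′)
    where
    eq  = constant e A≡ φ (m⊔n≤o⇒m≤o (pdepth φ) (pdepth ψ) d) a≤i
    eq′ = constant e A≡ ψ (m⊔n≤o⇒n≤o (pdepth φ) (pdepth ψ) d) a≤i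
  constant e {a} A≡ (φ U ψ) d {i} a≤i = mk⇔
    (λ (j , i≤j , h , _) → U-now {a} {φ} {ψ} (to (eq (≤-trans a≤i i≤j)) h))
    (λ (j , a≤j , h , _) → U-now {i} {φ} {ψ} (from (eq a≤i) (to (eq a≤j) h)))
    where
    eq : ∀ {j} → a ≤ j → Holds j ψ ⇔ Holds a ψ
    eq = constant e A≡ ψ (m⊔n≤o⇒n≤o (pdepth φ) (pdepth ψ) d)

  module Assignments {C : Set} (val : C → StateF k → Bool) (c : ℕ → C) (e : ℕ)
    (val-correct : ∀ i s → sdepth s ≤ e → T (val (c i) s) ⇔ A i s) where

    open Codes k
    open Tableau val

    Correct : ∀ φ → ℕ → Truth φ → Set
    Correct (state s) i _           = ⊤
    Correct (¬p φ)    i t           = Correct φ i t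
    Correct (φ ∧p ψ)  i (t , u)     = Correct φ i t × Correct ψ i u
    Correct (φ U ψ)   i (b , t , u) = (T b ⇔ Holds i (φ U ψ)) × Correct φ i t × Correct ψ i u

    eval-correct : ∀ φ → pdepth φ ≤ e → ∀ {i t} → Correct φ i t → T (eval φ (c i) t) ⇔ Holds i φ
    eval-correct (state s) d _ = val-correct _ s d
    eval-correct (¬p φ) d {i} {t} h = mk⇔ (λ ¬b h′ → T-not (eval φ (c i) t) ¬b (from eq h′))
                                          (λ ¬h → not-T (eval φ (c i) t) (¬h ∘ to eq))
      where
      eq = eval-correct φ d h
      T-not : ∀ b → T (not b) → ¬ T b
      T-not false _ ()
      not-T : ∀ b → ¬ T b → T (not b)
      not-T false _ = tt
      not-T true  n = n tt
    eval-correct (φ ∧p ψ) d {i} {t , u} (h , h′) =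
      mk⇔ (λ b → let b₁ , b₂ = to Bool.T-∧ b in to eq b₁ , to eq′ b₂)
          (λ (p , q) → from Bool.T-∧ (from eq p , from eq′ q))
      where
      eq  = eval-correct φ (m⊔n≤o⇒m≤o (pdepth φ) (pdepth ψ) d) h
      eq′ = eval-correct ψ (m⊔n≤o⇒n≤o (pdepth φ) (pdepth ψ) d) h′
    eval-correct (φ U ψ) d (h , _) = h

    -- Truth of an until along an arbitrary run is not decidable, hence the double negation.
    correct-exists : ∀ φ i → ¬ ¬ ∃ λ t → Correct φ i t
    correct-exists (state s) i none = none (tt , tt)
    correct-exists (¬p φ)    i none = correct-exists φ i none
    correct-exists (φ ∧p ψ)  i none = correct-exists φ i λ (t , h) →
      correct-exists ψ i λ (u , h′) → none ((t , u) , h , h′)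
    correct-exists (φ U ψ)   i none = correct-exists φ i λ (t , h) →
      correct-exists ψ i λ (u , h′) → ¬¬-excluded-middle {A = Holds i (φ U ψ)} λ
        { (yes p) → none ((true , t , u) , mk⇔ (λ _ → p) (λ _ → tt) , h , h′)
        ; (no np) → none ((false , t , u) , mk⇔ (λ ()) np , h , h′) }

    T-injective : ∀ {a b} → T a ⇔ T b → a ≡ b
    T-injective = Bool.⇔→≡ ∘ λ eq → mk⇔ (to Bool.T-≡ ∘ to eq ∘ from Bool.T-≡)
                                         (to Bool.T-≡ ∘ from eq ∘ from Bool.T-≡)

    correct-next : ∀ φ → pdepth φ ≤ e → ∀ {i t t′} →
                   Correct φ i t → Correct φ (suc i) t′ → Next φ (c i) t t′
    correct-next (state s) d _ _ = tt
    correct-next (¬p φ) d h h′ = correct-next φ d h h′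
    correct-next (φ ∧p ψ) d (h , h₁) (h′ , h₁′) =
      correct-next φ (m⊔n≤o⇒m≤o (pdepth φ) (pdepth ψ) d) h h′ ,
      correct-next ψ (m⊔n≤o⇒n≤o (pdepth φ) (pdepth ψ) d) h₁ h₁′
    correct-next (φ U ψ) d {i} (b , h , h₁) (b′ , h′ , h₁′) =
      T-injective (mk⇔ unfolds folds) , correct-next φ dφ h h′ , correct-next ψ dψ h₁ h₁′
      where
      dφ = m⊔n≤o⇒m≤o (pdepth φ) (pdepth ψ) d
      dψ = m⊔n≤o⇒n≤o (pdepth φ) (pdepth ψ) d
      eqφ = eval-correct φ dφ h
      eqψ = eval-correct ψ dψ h₁
      unfolds : T _ → T _
      unfolds p with U-unfold {i} {φ} {ψ} (to b p)
      ... | inj₁ q       = from Bool.T-∨ (inj₁ (from eqψ q))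
      ... | inj₂ (q , r) = from Bool.T-∨ (inj₂ (from Bool.T-∧ (from eqφ q , from b′ r)))
      folds : T _ → T _
      folds p with to Bool.T-∨ p
      ... | inj₁ q = from b (U-now {i} {φ} {ψ} (to eqψ q))
      ... | inj₂ q = let q₁ , q₂ = to Bool.T-∧ q
                     in from b (U-later {i} {φ} {ψ} (to eqφ q₁) (to b′ q₂))

    -- A true bit is carried forward by the expansion law until the right-hand argument holds, at
    -- the latest at the next fair position. Conversely, a witness of the until forces the bit
    -- backwards from its position to `i`.
    fair-correct : ∀ φ → pdepth φ ≤ e → (t : ℕ → Truth φ) →
      (∀ i → Next φ (c i) (t i) (t (suc i))) →
      All (λ f → ∀ i → ∃ λ j → i ≤ j × T (f (c j) (t j))) (fulfilments φ) →
      ∀ i → Correct φ i (t i)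
    fair-correct (state s) d t next fair i = tt
    fair-correct (¬p φ) d t next fair i = fair-correct φ d t next fair i
    fair-correct (φ ∧p ψ) d t next fair i =
      let fairφ , fairψ = All.++⁻ (map _ (fulfilments φ)) fair in
      fair-correct φ (m⊔n≤o⇒m≤o (pdepth φ) (pdepth ψ) d) (proj₁ ∘ t) (proj₁ ∘ next) (All.map⁻ fairφ) i ,
      fair-correct ψ (m⊔n≤o⇒n≤o (pdepth φ) (pdepth ψ) d) (proj₂ ∘ t) (proj₂ ∘ next) (All.map⁻ fairψ) i
    fair-correct (φ U ψ) d t next (fair ∷ fairs) = λ i →
      mk⇔ (λ b → let j , i≤j , f = fair i in
                 forward (proj₁ (m≤n⇒∃[o]m+o≡n i≤j))
                   (subst (λ j → T (not (proj₁ (t j)) ∨ eval ψ (c j) (proj₂ (proj₂ (t j)))))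
                          (sym (proj₂ (m≤n⇒∃[o]m+o≡n i≤j))) f) b)
          (λ (j , i≤j , h , h′) → let o , eq = m≤n⇒∃[o]m+o≡n i≤j in
             backward o (subst (λ j → Holds j ψ) (sym eq) h)
                        (λ l i≤l l< → h′ l i≤l (subst (l <_) eq l<))) ,
      cφ i , cψ i
      where
      dφ = m⊔n≤o⇒m≤o (pdepth φ) (pdepth ψ) d
      dψ = m⊔n≤o⇒n≤o (pdepth φ) (pdepth ψ) d
      fairφψ = All.++⁻ (map _ (fulfilments φ)) fairs
      cφ = fair-correct φ dφ (proj₁ ∘ proj₂ ∘ t) (proj₁ ∘ proj₂ ∘ next) (All.map⁻ (proj₁ fairφψ))
      cψ = fair-correct ψ dψ (proj₂ ∘ proj₂ ∘ t) (proj₂ ∘ proj₂ ∘ next) (All.map⁻ (proj₂ fairφψ))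
      eqφ : ∀ i → _
      eqφ i = eval-correct φ dφ (cφ i)
      eqψ : ∀ i → _
      eqψ i = eval-correct ψ dψ (cψ i)
      forward : ∀ {i} o → T (not (proj₁ (t (i + o))) ∨ eval ψ (c (i + o)) (proj₂ (proj₂ (t (i + o))))) →
                T (proj₁ (t i)) → Holds i (φ U ψ)
      forward {i} o f b with to Bool.T-∨ (subst T (proj₁ (next i)) b)
      ... | inj₁ p = U-now {i} {φ} {ψ} (to (eqψ i) p)
      -- At the fair position the bit is true, so the test can only have succeeded through `ψ`.
      forward {i} zero f b | inj₂ _ rewrite +-identityʳ i with proj₁ (t i)
      ... | true = U-now {i} {φ} {ψ} (to (eqψ i) f)
      forward {i} (suc o) f b | inj₂ p rewrite +-suc i o =
        U-later {i} {φ} {ψ} (to (eqφ i) (proj₁ (to Bool.T-∧ p))) (forward o f (proj₂ (to Bool.T-∧ p)))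
      backward : ∀ {i} o → Holds (i + o) ψ → (∀ l → i ≤ l → l < i + o → Holds l φ) → T (proj₁ (t i))
      backward {i} zero h _ rewrite +-identityʳ i =
        subst T (sym (proj₁ (next i))) (from Bool.T-∨ (inj₁ (from (eqψ i) h)))
      backward {i} (suc o) h h′ rewrite +-suc i o =
        subst T (sym (proj₁ (next i))) (from Bool.T-∨ (inj₂ (from Bool.T-∧
          (from (eqφ i) (h′ i ≤-refl (s≤s (m≤m+n i o))) ,
           backward o h λ l i<l → h′ l (<⇒≤ i<l)))))

-- Maximal paths as infinite runs.

module Unrolling {k} (I : Instance k) where
  open System I

  open module Run (ρ : ℕ → V) = Omega (λ i → ssat I (ρ i)) public using (Holds)

  InDom-≤ : ∀ {len l j} → l ≤ j → InDom len j → InDom len l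
  InDom-≤ {nothing} _   _   = tt
  InDom-≤ {just m}  l≤j j≤m = ≤-trans l≤j j≤m

  module _ {v} (π : MaxPath (G I) v) (ρ : ℕ → V)
    (agree : ∀ i → InDom (len π) i → seq π i ≡ ρ i)
    (rest : ∀ m → len π ≡ just m → ∀ i → m ≤ i → ρ i ≡ ρ m) where

    -- The two semantics differ only for an until witnessed beyond the last index `m`; the run is
    -- constant from `m` on, so `m` is then a witness as well.
    psat⇔Holds : ∀ φ i → InDom (len π) i → psat I π i φ ⇔ Holds ρ i φ
    psat⇔Holds (state s) i di rewrite agree i di = ⇔-id _
    psat⇔Holds (¬p φ) i di = mk⇔ (_∘ from eq) (_∘ to eq)
      where eq = psat⇔Holds φ i di
    psat⇔Holds (φ ∧p ψ) i di = mk⇔ (λ (h , h′) → to eq h , to eq′ h′) (λ (h , h′) → from eq h , from eq′ h′)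
      where
      eq  = psat⇔Holds φ i di
      eq′ = psat⇔Holds ψ i di
    psat⇔Holds (φ U ψ) i di = mk⇔
      (λ (j , i≤j , dj , h , h′) → j , i≤j , to (psat⇔Holds ψ j dj) h ,
        λ l i≤l l<j → to (psat⇔Holds φ l (InDom-≤ (<⇒≤ l<j) dj)) (h′ l i≤l l<j))
      (λ (j , i≤j , h , h′) → let j′ , i≤j′ , j′≤j , dj , h = shorten j i≤j h in
        j′ , i≤j′ , dj , from (psat⇔Holds ψ j′ dj) h ,
        λ l i≤l l<j → from (psat⇔Holds φ l (InDom-≤ (<⇒≤ l<j) dj)) (h′ l i≤l (<-≤-trans l<j j′≤j)))
      where
      shorten : ∀ j → i ≤ j → Holds ρ j ψ →
                ∃ λ j′ → i ≤ j′ × j′ ≤ j × InDom (len π) j′ × Holds ρ j′ ψ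
      shorten j i≤j h with len π
      ... | nothing = j , i≤j , ≤-refl , tt , h
      ... | just m with j ≤? m
      ...   | yes j≤m = j , i≤j , ≤-refl , j≤m , h
      ...   | no  j≰m = m , di , <⇒≤ (≰⇒> j≰m) , ≤-refl ,
        to (Omega.constant (λ i → ssat I (ρ i)) (pdepth ψ)
             (λ i s m≤i _ → subst (λ w → ssat I w s ⇔ ssat I (ρ m) s) (sym (rest m refl i m≤i)) (⇔-id _))
             ψ ≤-refl (<⇒≤ (≰⇒> j≰m))) h

  record Run∞ (v : V) : Set where
    field
      at       : ℕ → V
      at-start : at 0 ≡ v
      at-step  : ∀ i → Step (at i) (at (suc i))
  open Run∞ public

  unroll : ∀ {v} (π : MaxPath (G I) v) → Σ (Run∞ v) λ ρ → ∀ φ → psat I π 0 φ ⇔ Holds (at ρ) 0 φ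
  unroll {v} π with len π in eq
  ... | nothing = record { at = seq π ; at-start = start π ; at-step = λ i → inj₁ (steps π i (dom (suc i))) } ,
    λ φ → psat⇔Holds π (seq π) (λ _ _ → refl) (λ m eq′ → contradiction (trans (sym eq) eq′) λ ()) φ 0 (dom 0)
    where
    dom : ∀ i → InDom (len π) i
    dom i rewrite eq = tt
  ... | just m = record { at = λ i → seq π (i ⊓ m) ; at-start = start π ; at-step = stepping } ,
    λ φ → psat⇔Holds π (λ i → seq π (i ⊓ m))
      (λ i di → cong (seq π) (sym (m≤n⇒m⊓n≡m (subst (λ l → InDom l i) eq di))))
      (λ { m′ eq′ → rest m′ (trans (sym eq) eq′) })
      φ 0 (subst (λ l → InDom l 0) (sym eq) z≤n)
    where
    rest : ∀ m′ → just m ≡ just m′ → ∀ i → m′ ≤ i → seq π (i ⊓ m) ≡ seq π (m′ ⊓ m)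
    rest _ refl i m≤i = cong (seq π) (trans (m≥n⇒m⊓n≡n m≤i) (sym (⊓-idem _)))
    stepping : ∀ i → Step (seq π (i ⊓ m)) (seq π (suc i ⊓ m))
    stepping i with suc i ≤? m
    ... | yes i<m rewrite m≤n⇒m⊓n≡m i<m | m≤n⇒m⊓n≡m (<⇒≤ i<m) =
      inj₁ (steps π i (subst (λ l → InDom l (suc i)) (sym eq) i<m))
    ... | no  i≮m with m≤i ← ≤-pred (≰⇒> i≮m)
      rewrite m≥n⇒m⊓n≡n m≤i | m≥n⇒m⊓n≡n (m≤n⇒m≤1+n m≤i) = inj₂ (refl , maximal π m eq)

  dead-rest : ∀ {v} (ρ : Run∞ v) {i} → Dead (at ρ i) → ∀ j → i ≤ j → at ρ j ≡ at ρ i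
  dead-rest ρ {i} dead j i≤j with o , refl ← m≤n⇒∃[o]m+o≡n i≤j = go o
    where
    go : ∀ o → at ρ (i + o) ≡ at ρ i
    go zero    = cong (at ρ) (+-identityʳ i)
    go (suc o) rewrite +-suc i o with at-step ρ (i + o)
    ... | inj₁ s        = contradiction (subst (λ v → Edge (G I) v (at ρ (suc (i + o)))) (go o) s) (dead _)
    ... | inj₂ (eq , _) = trans (sym eq) (go o)

  -- The recurring vertex decides whether the run stands for a finite path.
  roll : ∀ {v} (ρ : Run∞ v) r → (∀ i → ∃ λ j → i ≤ j × at ρ j ≡ r) →
         Σ (MaxPath (G I) v) λ π → ∀ φ → psat I π 0 φ ⇔ Holds (at ρ) 0 φ
  roll ρ r recurs with dead? r
  ... | no alive = π , λ φ → psat⇔Holds π (at ρ) (λ _ _ → refl) (λ _ ()) φ 0 tt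
    where
    edge : ∀ i → Edge (G I) (at ρ i) (at ρ (suc i))
    edge i with at-step ρ i
    ... | inj₁ s          = s
    ... | inj₂ (_ , dead) with j , i≤j , refl ← recurs i =
      contradiction (subst Dead (sym (dead-rest ρ dead j i≤j)) dead) alive
    π : MaxPath (G I) _
    π = record { seq = at ρ ; len = nothing ; start = at-start ρ ; steps = λ i _ → edge i ; maximal = λ _ () }
  ... | yes dead-r with j , _ , refl ← recurs 0 =
    let m , dead-m , alive = first j dead-r
        π = record { seq = at ρ ; len = just m ; start = at-start ρ
                   ; steps = λ i i<m → edge i (alive i i<m) ; maximal = λ { _ refl → dead-m } }
    in π , λ φ → psat⇔Holds π (at ρ) (λ _ _ → refl) (λ { _ refl → dead-rest ρ dead-m }) φ 0 z≤n
    where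
    edge : ∀ i → ¬ Dead (at ρ i) → Edge (G I) (at ρ i) (at ρ (suc i))
    edge i alive with at-step ρ i
    ... | inj₁ s          = s
    ... | inj₂ (_ , dead) = contradiction dead alive
    first : ∀ j → Dead (at ρ j) → ∃ λ m → Dead (at ρ m) × (∀ i → i < m → ¬ Dead (at ρ i))
    first zero    dead = zero , dead , λ _ ()
    first (suc j) dead with dead? (at ρ j)
    ... | yes dead′ = first j dead′
    -- A dead vertex is repeated forever, so a live one at `j` excludes dead ones before it.
    ... | no  alive = suc j , dead , λ i i≤j dead-i →
      alive (subst Dead (sym (dead-rest ρ dead-i j (≤-pred i≤j))) dead-i)

-- Runs of an automaton along an instance

unsnoc : {A : Set} {R : A → A → Set} {a b c : A} → R a b → Star R b c → ∃ λ d → Star R a d × R d c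
unsnoc r ε = _ , ε , r
unsnoc r (r′ ◅ p) with d , q , last ← unsnoc r′ p = d , r ◅ q , last

module Configurations {k} (I : Instance k) {e} (𝔸 : Automaton (Codes.Code k e))
  (γ : Fin k → Codes.Code k (suc e)) (γ≡ : ∀ i → γ i ≡ System.code I (suc e) (g I i)) where
  open System I
  open Codes k
  open Automaton 𝔸
  open Macro 𝔸 γ

  Config : Set
  Config = V × State

  infix 4 _↦_
  _↦_ : Config → Config → Set
  (v , p) ↦ (w , q) = Step v w × Next (code e v) p q

  Seg-head : ∀ {v ws x} → Seg (code e) v ws x → ∃ λ ws′ → ws ≡ code e v ∷ ws′
  Seg-head (leave _)          = _ , refl
  Seg-head (move _ _ _ _)     = _ , refl
  Seg-head (stutter _ _ eq p) with ws′ , refl ← Seg-head p = ws′ , cong (_∷ ws′) eq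

  run-merge : ∀ {x a ws p q r} → Next a p q → Run x (a ∷ ws) q r → Run x (a ∷ ws) p r
  run-merge {just _}  n (inj₁ (eq , l))     = inj₁ (eq , merge n l)
  run-merge {nothing} n (inj₁ (eq , l , f)) = inj₁ (eq , merge n l , f)
  run-merge           n (inj₂ (_ , n′ , l)) = inj₂ (_ , merge n n′ , l)

  run-split : ∀ {x a ws p r} → Run x (a ∷ ws) p r → ∃ λ q → Next a p q × Run x (a ∷ ws) q r
  run-split {just _}  (inj₁ (eq , l))     = let q , n , n′ = split l in q , n , inj₁ (eq , n′)
  run-split {nothing} (inj₁ (eq , l , f)) = let q , n , n′ = split l in q , n , inj₁ (eq , n′ , f)
  run-split           (inj₂ (_ , m , l))  = let q , n , n′ = split m in q , n , inj₂ (_ , n′ , l)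

  -- Built from the end: a step into a marked vertex closes a segment and opens a node, a blank step
  -- prolongs the first word, and a step keeping the code is absorbed by `merge`.
  compress : ∀ {v p u q x r} → Star _↦_ (v , p) (u , q) → Leaves u x → Last x (code e u) q r →
             Reach (code (suc e) v) p (x , r)
  compress ε l last = _ , (_ , Seg⇒Lang e (leave l) , inj₁ (refl , last)) , ε
  compress {v} (_◅_ {j = w , _} (s , n) path) l last
    with blank-or-g w | compress path l last
  ... | inj₂ (i , refl) | t , first , nodes =
    (just i , _) , (_ , Seg⇒Lang e {x = just i} (leave s) , inj₁ (refl , n)) ,
    subst (λ c → First c _ t) (sym (γ≡ i)) first ◅ nodes
  ... | inj₁ b | t , (ws , lang , run) , nodes
    with seg ← Lang⇒Seg e lang | code e w ≟ᶜ code e v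
  ...   | no  neq = t , (_ , Seg⇒Lang e (move s b neq seg) , inj₂ (_ , n , run)) , nodes
  ...   | yes eq with ws′ , refl ← Seg-head seg =
    t , (_ , Seg⇒Lang e (stutter s b eq seg) ,
         run-merge {ws = ws′} (subst (λ a → Next a _ _) (sym eq) n) run) , nodes

  -- The word has a single letter for a whole block of stuttering vertices; `split` supplies the
  -- states for the extra readings.
  expand-seg : ∀ {v ws x p r} → Seg (code e) v ws x → Run x ws p r →
               ∃₂ λ u q → Star _↦_ (v , p) (u , q) × Leaves u x × Last x (code e u) q r
  expand-seg (leave l) (inj₁ (_ , last)) = _ , _ , ε , l , last
  expand-seg (stutter s b eq seg) run with ws′ , refl ← Seg-head seg =
    let q , n , run′ = run-split {ws = ws′} run
        u , q′ , path , rest = expand-seg seg run′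
    in u , q′ , (s , subst (λ a → Next a _ _) eq n) ◅ path , rest
  expand-seg (move s b neq seg) (inj₁ (refl , _)) with () ← Seg-head seg
  expand-seg (move s b neq seg) (inj₂ (q , n , run)) =
    let u , q′ , path , rest = expand-seg seg run in u , q′ , (s , n) ◅ path , rest

  leaving : ∀ {i u q r} → Leaves u (just i) × Last (just i) (code e u) q r → (u , q) ↦ (g I i , r)
  leaving (s , n) = s , n

  expand : ∀ {v p t x r} → First (code (suc e) v) p t → Star _⟶_ t (x , r) →
           ∃₂ λ u q → Star _↦_ (v , p) (u , q) × Leaves u x × Last x (code e u) q r
  expand (ws , lang , run) ε = expand-seg (Lang⇒Seg e lang) run
  expand {t = just i , _} (ws , lang , run) (first ◅ nodes) =
    let u , q , path , l = expand-seg (Lang⇒Seg e lang) run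
        u′ , q′ , path′ , rest = expand (subst (λ c → First c _ _) (γ≡ i) first) nodes
    in u′ , q′ , path ◅◅ leaving {i} l ◅ path′ , rest

-- Lassos: infinite runs around a cycle.

module Lasso {A : Set} (R : A → A → Set) where

  -- Only sources of steps count, so a visit makes the path nonempty.
  Visits : (A → Set) → ∀ {a b} → Star R a b → Set
  Visits P ε             = ⊥
  Visits P (_◅_ {a} _ p) = P a ⊎ Visits P p

  visits-◅◅ˡ : ∀ {P : A → Set} {a b c} (p : Star R a b) {q : Star R b c} → Visits P p → Visits P (p ◅◅ q)
  visits-◅◅ˡ (_ ◅ p) (inj₁ h) = inj₁ h
  visits-◅◅ˡ (_ ◅ p) (inj₂ h) = inj₂ (visits-◅◅ˡ p h)

  visits-◅◅ʳ : ∀ {P : A → Set} {a b c} (p : Star R a b) {q : Star R b c} → Visits P q → Visits P (p ◅◅ q)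
  visits-◅◅ʳ ε       h = h
  visits-◅◅ʳ (_ ◅ p) h = inj₂ (visits-◅◅ʳ p h)

  Tour : A → (A → Set) → Set
  Tour a P = ∃₂ λ b c → P b × Star R a b × R b c × Star R c a

  grand-tour : ∀ {a} {Ps : List (A → Set)} → All (Tour a) Ps →
               Σ (Star R a a) λ p → All (λ P → Visits P p) Ps
  grand-tour [] = ε , []
  grand-tour ((_ , _ , h , p , r , q) ∷ tours) =
    let p′ , visits = grand-tour tours
    in (p ◅◅ r ◅ q) ◅◅ p′ ,
       visits-◅◅ˡ (p ◅◅ r ◅ q) (visits-◅◅ʳ p (inj₁ h)) ∷ All.map (visits-◅◅ʳ (p ◅◅ r ◅ q)) visits

  module _ {hub m : A} (depart : R hub m) (return : Star R m hub) where

    -- The state of the endless journey is the remaining route to the hub; when it is used up, the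
    -- cycle starts again.
    Travel : Set
    Travel = ∃ λ a → Star R a hub

    travel : Travel → Travel
    travel (_ , ε)     = m , return
    travel (_ , _ ◅ p) = _ , p

    after : Travel → ℕ → Travel
    after t zero    = t
    after t (suc i) = after (travel t) i

    after-+ : ∀ t i o → after t (i + o) ≡ after (after t i) o
    after-+ t zero    o = refl
    after-+ t (suc i) o = after-+ (travel t) i o

    travel-step : ∀ t → R (proj₁ t) (proj₁ (travel t))
    travel-step (_ , ε)     = depart
    travel-step (_ , r ◅ _) = r

    after-step : ∀ t i → R (proj₁ (after t i)) (proj₁ (after t (suc i)))
    after-step t zero    = travel-step t
    after-step t (suc i) = after-step (travel t) i

    home : ∀ {a} (p : Star R a hub) → ∃ λ o → after (a , p) o ≡ (hub , ε)
    home ε       = zero , refl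
    home (_ ◅ p) = let o , eq = home p in suc o , eq

    sight : ∀ {P : A → Set} {a} (p : Star R a hub) → Visits P p → ∃ λ o → P (proj₁ (after (a , p) o))
    sight (_ ◅ p) (inj₁ h) = zero , h
    sight (_ ◅ p) (inj₂ h) = let o , h′ = sight p h in suc o , h′

    infinitely-often : ∀ {P : A → Set} → Visits P (depart ◅ return) →
                       ∀ t i → ∃ λ j → i ≤ j × P (proj₁ (after t j))
    infinitely-often {P} visit t i =
      let o , eq = home (proj₂ (after t i))
          o′ , h = again visit
      in (i + o) + o′ , ≤-trans (m≤m+n i o) (m≤m+n (i + o) o′) ,
         subst (P ∘ proj₁) (sym (trans (after-+ t (i + o) o′)
           (cong (λ t → after t o′) (trans (after-+ t i o) eq)))) h
      where
      again : Visits P (depart ◅ return) → ∃ λ o → P (proj₁ (after (hub , ε) o))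
      again (inj₁ h) = zero , h
      again (inj₂ h) = let o , h′ = sight return h in suc o , h′

    recurrent-hub : ∀ t i → ∃ λ j → i ≤ j × proj₁ (after t j) ≡ hub
    recurrent-hub t i = let o , eq = home (proj₂ (after t i)) in
      i + o , m≤m+n i o , cong proj₁ (trans (after-+ t i o) eq)

-- The infinite pigeonhole principle under double negation.

module _ {X : Set} (P : ℕ → X → Set) where

  Inf : X → Set
  Inf x = ∀ p → ¬ ¬ ∃ λ j → p ≤ j × P j x

  -- If each value occurred only up to some position, the maximum of these finitely many bounds
  -- would bound all occurrences.
  infinite-pigeonhole : Finite X → (∀ p → ¬ ¬ ∃₂ λ j x → p ≤ j × P j x) → ¬ ¬ ∃ Inf
  infinite-pigeonhole (xs , ∈xs) often none = bound xs λ (p , never) →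
    often p λ (j , x , p≤j , h) → never (∈xs x) p≤j h
    where
    bound : ∀ ys → ¬ ¬ ∃ λ p → ∀ {y j} → y ∈ ys → p ≤ j → ¬ P j y
    bound []       nb = nb (zero , λ ())
    bound (y ∷ ys) nb = bound ys λ (p , never) → none (y , λ q fin → nb (p ⊔ q , λ
      { (here refl) pq≤j h → fin (_ , ≤-trans (m≤n⊔m p q) pq≤j , h)
      ; (there y∈)  pq≤j h → never y∈ (≤-trans (m≤m⊔n p q) pq≤j) h }))

all-¬¬ : {A : Set} {P : A → Set} {xs : List A} → All (λ a → ¬ ¬ P a) xs → ¬ ¬ All P xs
all-¬¬ []       n = n []
all-¬¬ (h ∷ hs) n = h λ p → all-¬¬ hs λ ps → n (p ∷ ps)

-- Model checking on codes

module ModelChecking {k} (I : Instance k) (e : ℕ) (val : Codes.Code k e → StateF k → Bool)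
  (val-correct : ∀ v s → sdepth s ≤ e → T (val (System.code I e v) s) ⇔ ssat I v s)
  (γ : Fin k → Codes.Code k (suc e)) (γ≡ : ∀ i → γ i ≡ System.code I (suc e) (g I i))
  (φ : PathF k) (φ-depth : pdepth φ ≤ e) where

  open System I
  open Codes k
  open Unrolling I
  open Acceptance val γ φ
  module Track = Configurations I (automaton φ) γ γ≡
  module Watch (f : Test φ) = Configurations I (monitor φ f) γ γ≡
  open Track using (Config; _↦_)

  passes : Test φ → Config → Set
  passes f (v , t) = T (f (code e v) t)

  unwatch : ∀ f {s t} → Star (Watch._↦_ f) s t →
            Star _↦_ (proj₁ s , proj₁ (proj₂ s)) (proj₁ t , proj₁ (proj₂ t))
  unwatch f = gmap (λ (v , t , _) → v , t) (λ (s , n , _) → s , n)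

  module Completeness {v} (ρ : Run∞ v) where
    open Omega (λ i → ssat I (at ρ i)) using (constant; U-now; module Assignments)
    open Assignments val (code e ∘ at ρ) e (λ i → val-correct (at ρ i))

    now : ∀ {S : Set} → ℕ → S → V × S
    now i t = at ρ i , t

    correct-unique : ∀ ψ {i t t′} → Correct ψ i t → Correct ψ i t′ → t ≡ t′
    correct-unique (state s) _ _ = refl
    correct-unique (¬p ψ) h h′ = correct-unique ψ h h′
    correct-unique (ψ ∧p χ) (h , h₁) (h′ , h₁′) = cong₂ _,_ (correct-unique ψ h h′) (correct-unique χ h₁ h₁′)
    correct-unique (ψ U χ) (b , h , h₁) (b′ , h′ , h₁′) =
      cong₂ _,_ (T-injective (mk⇔ (from b′ ∘ to b) (from b ∘ to b′)))
                (cong₂ _,_ (correct-unique ψ h h′) (correct-unique χ h₁ h₁′))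

    -- Intermediate assignments exist only under double negation, one for each position; uniqueness
    -- of correct assignments makes the run end in the prescribed one.
    watched : ∀ f i o {t t′} b → Correct φ i t → Correct φ (i + o) t′ →
              ¬ ¬ ∃ λ b′ → Star (Watch._↦_ f) (now i (t , b)) (now (i + o) (t′ , b′)) × (T b → T b′)
    watched f i zero b h h′ none rewrite +-identityʳ i with refl ← correct-unique φ h h′ =
      none (b , ε , λ x → x)
    watched f i (suc o) {t} b h h′ none rewrite +-suc i o = correct-exists φ (suc i) λ (t₁ , h₁) →
      watched f (suc i) o (b ∨ f (code e (at ρ i)) t) h₁ h′ λ (b′ , path , mono) →
      none (b′ , (at-step ρ i , correct-next φ φ-depth h h₁ , refl) ◅ path ,
            mono ∘ from Bool.T-∨ ∘ inj₁)

    tracked : ∀ {i j t t′} → i ≤ j → Correct φ i t → Correct φ j t′ →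
              ¬ ¬ Star _↦_ (now i t) (now j t′)
    tracked {i} i≤j h h′ none with o , refl ← m≤n⇒∃[o]m+o≡n i≤j =
      watched (λ _ _ → true) i o false h h′ λ (_ , path , _) → none (unwatch (λ _ _ → true) path)

    Fair : ∀ ψ → Test ψ → Set
    Fair ψ f = ∀ p → ¬ ¬ ∃ λ q → p ≤ q × (∀ t → Correct ψ q t → T (f (code e (at ρ q)) t))

    fulfilments-fair : ∀ ψ → pdepth ψ ≤ e → All (Fair ψ) (fulfilments ψ)
    fulfilments-fair (state s) d = []
    fulfilments-fair (¬p ψ) d = fulfilments-fair ψ d
    fulfilments-fair (ψ ∧p χ) d = All.++⁺
      (All.map⁺ (All.map (λ fair p none → fair p λ (q , p≤q , h) → none (q , p≤q , λ t c → h _ (proj₁ c)))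
        (fulfilments-fair ψ (m⊔n≤o⇒m≤o (pdepth ψ) (pdepth χ) d))))
      (All.map⁺ (All.map (λ fair p none → fair p λ (q , p≤q , h) → none (q , p≤q , λ t c → h _ (proj₂ c)))
        (fulfilments-fair χ (m⊔n≤o⇒n≤o (pdepth ψ) (pdepth χ) d))))
    fulfilments-fair (ψ U χ) d = fair-U ∷ All.++⁺
      (All.map⁺ (All.map (λ fair p none → fair p λ (q , p≤q , h) → none (q , p≤q , λ t c → h _ (proj₁ (proj₂ c))))
        (fulfilments-fair ψ (m⊔n≤o⇒m≤o (pdepth ψ) (pdepth χ) d))))
      (All.map⁺ (All.map (λ fair p none → fair p λ (q , p≤q , h) → none (q , p≤q , λ t c → h _ (proj₂ (proj₂ c))))
        (fulfilments-fair χ dχ)))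
      where
      dχ = m⊔n≤o⇒n≤o (pdepth ψ) (pdepth χ) d
      fair-U : Fair (ψ U χ) λ c (b , _ , u) → not b ∨ eval χ c u
      -- Either the until holds at `p`, and its witness fulfils it, or its bit at `p` is false.
      fair-U p none = ¬¬-excluded-middle {A = Holds (at ρ) p (ψ U χ)} λ
        { (yes (j , p≤j , h , _)) → none (j , p≤j , λ t c →
            from Bool.T-∨ (inj₂ (from (eval-correct χ dχ (proj₂ (proj₂ c))) h)))
        ; (no fails) → none (p , ≤-refl , λ { (false , _) _ → tt
                                           ; (true  , _) c → ⊥-elim (fails (to (proj₁ c) tt)) }) }

    tests-fair : All (Fair φ) tests
    tests-fair = (λ p none → none (p , ≤-refl , λ _ _ → tt)) ∷ fulfilments-fair φ φ-depth

    module _ {t₀} (start-correct : Correct φ 0 t₀) where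

      code₀ : Code (suc e)
      code₀ = code (suc e) (at ρ 0)

      Good : Set
      Good = ∃ λ s → Main.Reach code₀ t₀ s × Recurrent s

      -- Some marked vertex recurs infinitely often with one and the same correct assignment. This
      -- pair is the recurrent node: each test succeeds somewhere between two of its occurrences.
      named : (¬ ∃ λ p → ∀ j → p ≤ j → Blank (at ρ j)) → ¬ ¬ Good
      named returns none =
        infinite-pigeonhole P (finite-× finite-Fin (finite-Truth φ)) often λ ((i , t) , inf) →
        -- An occurrence after position 0, so that a step leads into it.
        inf 1 λ { (suc a , _ , eq , h) →
        correct-exists φ a λ (t′ , h′) →
        tracked z≤n start-correct h′ λ path →
        all-¬¬ (All.map (λ {f} → recurs eq h inf f) tests-fair) λ rec →
        none ((just i , t) ,
          Track.compress path (subst (Step (at ρ a)) eq (at-step ρ a)) (correct-next φ φ-depth h′ h) ,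
          rec) }
        where
        P : ℕ → Fin k × Truth φ → Set
        P j (i , t) = at ρ j ≡ g I i × Correct φ j t
        often : ∀ p → ¬ ¬ ∃₂ λ j x → p ≤ j × P j x
        often p none = returns (p , blanks)
          where
          blanks : ∀ j → p ≤ j → Blank (at ρ j)
          blanks j p≤j with blank-or-g (at ρ j)
          ... | inj₁ b        = b
          ... | inj₂ (i , eq) = contradiction (λ (t , h) → none (j , (i , t) , p≤j , eq , h)) (correct-exists φ j)
        recurs : ∀ {a i t} → at ρ a ≡ g I i → Correct φ a t → Inf P (i , t) →
                 ∀ f → Fair φ f → ¬ ¬ Monitor.Reach f (γ i) (t , false) (just i , t , true)
        recurs {a} {i} {t} eq h inf f fair none = fair a λ (q , a≤q , success) →
          -- The return comes strictly after `q`, so that the cycle contains the step that reads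
          -- position `q`.
          inf (suc q) λ { (suc z , s≤s q≤z , eq′ , h′) →
          correct-exists φ q λ (u , hu) → correct-exists φ (suc q) λ (u₁ , hu₁) →
          go (m≤n⇒∃[o]m+o≡n a≤q) (m≤n⇒∃[o]m+o≡n (s≤s q≤z)) hu hu₁ (success u hu) eq′ h′ }
          where
          go : ∀ {q z u u₁} → (∃ λ o → a + o ≡ q) → (∃ λ o → suc q + o ≡ suc z) →
               Correct φ q u → Correct φ (suc q) u₁ → T (f (code e (at ρ q)) u) →
               at ρ (suc z) ≡ g I i → Correct φ (suc z) t → ⊥
          go {q} {u = u} (o , refl) (o′ , refl) hu hu₁ success eq′ h′ =
            watched f a o false h hu λ (b , path , _) →
            watched f (suc q) o′ (b ∨ f (code e (at ρ q)) u) hu₁ h′ λ (b′ , path′ , mono) →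
            finish path ((at-step ρ q , correct-next φ φ-depth hu hu₁ , refl)) path′
              (to Bool.T-≡ (mono (from Bool.T-∨ (inj₂ success)))) eq′
            where
            finish : ∀ {y z w b′} → Star (Watch._↦_ f) (now a (t , false)) y → Watch._↦_ f y z →
                     Star (Watch._↦_ f) z (w , t , b′) → b′ ≡ true → w ≡ g I i → ⊥
            finish path step path′ refl refl with y , rest , s , n ← unsnoc step path′ =
              none (subst (λ c → Monitor.Reach f c (t , false) (just i , t , true)) (trans (cong (code (suc e)) eq) (sym (γ≡ i)))
                (Watch.compress f {x = just i} (path ◅◅ rest) s n))

      -- Some vertex recurs infinitely often. Codes descend along the blank tail and keep coming
      -- back to its code, so from one occurrence on they are constant, and with them the correct
      -- assignment.
      unnamed : ∀ p → (∀ j → p ≤ j → Blank (at ρ j)) → ¬ ¬ Good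
      unnamed p blanks none =
        infinite-pigeonhole (λ j u → at ρ j ≡ u) finite-Fin (λ q no → no (q , _ , ≤-refl , refl)) λ (u , inf) →
        -- Two occurrences `a < b` close the blank cycle.
        inf p λ { (a , p≤a , refl) → inf (suc a) λ (b , a<b , eq) →
        correct-exists φ a λ (t , h) →
        tracked z≤n start-correct h λ path →
        let code-constant = λ i a≤i → decidable-stable (code e (at ρ i) ≟ᶜ code e (at ρ a)) λ differ →
              inf i λ (j , i≤j , eq) → differ (≼-antisym (descends e (wander p≤a a≤i))
                (subst (λ w → code e w ≼ code e (at ρ i)) eq (descends e (wander (≤-trans p≤a a≤i) i≤j))))
            t-correct = correct-constant φ φ-depth code-constant h
            next = correct-next φ φ-depth h (t-correct (suc a) (n≤1+n a))
        in none ((nothing , t) , Track.compress {x = nothing} path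
             (at ρ (suc a) , (at-step ρ a , blanks (suc a) (m≤n⇒m≤1+n p≤a)) ,
               subst (Star BlankStep (at ρ (suc a))) eq (wander (m≤n⇒m≤1+n p≤a) a<b))
             (next , next , All.map (λ {f} fair → decidable-stable (Bool.T? _) λ fails →
               fair a λ (q , a≤q , success) →
               fails (subst (λ c → T (f c t)) (code-constant q a≤q) (success t (t-correct q a≤q))))
               (fulfilments-fair φ φ-depth)) , tt) }
        where
        wander : ∀ {i j} → p ≤ i → i ≤ j → Star BlankStep (at ρ i) (at ρ j)
        wander {i} p≤i i≤j with o , refl ← m≤n⇒∃[o]m+o≡n i≤j = go o p≤i
          where
          go : ∀ {i} o → p ≤ i → Star BlankStep (at ρ i) (at ρ (i + o))
          go {i} zero    p≤i rewrite +-identityʳ i = ε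
          go {i} (suc o) p≤i rewrite +-suc i o =
            (at-step ρ i , blanks (suc i) (m≤n⇒m≤1+n p≤i)) ◅ go o (m≤n⇒m≤1+n p≤i)
        correct-constant : ∀ ψ → pdepth ψ ≤ e → ∀ {a t} →
          (∀ i → a ≤ i → code e (at ρ i) ≡ code e (at ρ a)) → Correct ψ a t → ∀ i → a ≤ i → Correct ψ i t
        correct-constant (state s) d eq h i a≤i = tt
        correct-constant (¬p ψ) d eq h i a≤i = correct-constant ψ d eq h i a≤i
        correct-constant (ψ ∧p χ) d eq (h , h′) i a≤i =
          correct-constant ψ (m⊔n≤o⇒m≤o (pdepth ψ) (pdepth χ) d) eq h i a≤i ,
          correct-constant χ (m⊔n≤o⇒n≤o (pdepth ψ) (pdepth χ) d) eq h′ i a≤i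
        correct-constant (ψ U χ) d {a} eq (b , h , h′) i a≤i =
          mk⇔ (from steady ∘ to b) (from b ∘ to steady) ,
          correct-constant ψ (m⊔n≤o⇒m≤o (pdepth ψ) (pdepth χ) d) eq h i a≤i ,
          correct-constant χ (m⊔n≤o⇒n≤o (pdepth ψ) (pdepth χ) d) eq h′ i a≤i
          where
          same : ∀ i s → a ≤ i → sdepth s ≤ e → ssat I (at ρ i) s ⇔ ssat I (at ρ a) s
          same i s a≤i d = mk⇔
            (λ h → to (val-correct _ s d) (subst (λ c → T (val c s)) (eq i a≤i) (from (val-correct _ s d) h)))
            (λ h → to (val-correct _ s d) (subst (λ c → T (val c s)) (sym (eq i a≤i)) (from (val-correct _ s d) h)))
          steady = constant e same (ψ U χ) d a≤i

    -- Acceptance is decidable, which discharges the double negations and the case split on whether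
    -- the run is eventually blank.
    complete : Holds (at ρ) 0 φ → Accepts (code (suc e) v)
    complete holds = decidable-stable (accepts? _) λ rejects →
      correct-exists φ 0 λ (t , h) →
      ¬¬-excluded-middle λ dec → good h dec λ s →
      rejects (t ,
        subst (λ c → T (eval φ c t)) (trans (cong (code e) (at-start ρ)) (sym (pr-code e v)))
              (from (eval-correct φ φ-depth h) holds) ,
        subst (λ w → ∃ λ s → Main.Reach (code (suc e) w) t s × Recurrent s) (at-start ρ) s)
      where
      good : ∀ {t} (h : Correct φ 0 t) → Dec (∃ λ p → ∀ j → p ≤ j → Blank (at ρ j)) → ¬ ¬ Good h
      good h (yes (p , blanks)) = unnamed h p blanks
      good h (no returns)       = named h returns

  open Lasso _↦_

  -- The constant test makes the combined tour nonempty. Repeating it forever yields a fair tableau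
  -- run, whose assignments are correct by `fair-correct`.
  lasso-sound : ∀ {v t hub} → Star _↦_ (v , t) hub → All (Tour hub) (map passes tests) →
                T (eval φ (code e v) t) → Σ (MaxPath (G I) v) λ π → psat I π 0 φ
  lasso-sound {v} {t} approach tours accepted with grand-tour tours
  ... | ε , () ∷ _
  ... | (depart ◅ return) , _ ∷ visits =
    let π , eq = roll ρ _ λ i → let j , i≤j , eq = recurrent-hub depart return (_ , approach) i
                                in j , i≤j , cong proj₁ eq
    in π , from (eq φ) (to (eval-correct φ φ-depth (fair-correct φ φ-depth (proj₂ ∘ config)
      (proj₂ ∘ config-step) (All.map (λ visit → infinitely-often depart return visit (_ , approach)) (All.map⁻ visits)) 0)) accepted)
    where
    config : ℕ → Config
    config i = proj₁ (after depart return (_ , approach) i)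
    config-step : ∀ i → config i ↦ config (suc i)
    config-step = after-step depart return (_ , approach)
    ρ : Run∞ v
    ρ = record { at = proj₁ ∘ config ; at-start = refl ; at-step = proj₁ ∘ config-step }
    open Omega.Assignments (λ i → ssat I (at ρ i)) val (code e ∘ at ρ) e (λ i → val-correct (at ρ i))

  -- The monitor's bit can only switch from false to true where the test succeeds.
  monitored-tour : ∀ f {v p w q b hub} → Star (Watch._↦_ f) (v , p , false) (w , q , b) →
    (w , q) ↦ hub → true ≡ b ∨ f (code e w) q →
    ∃₂ λ y z → passes f y × Star _↦_ (v , p) y × y ↦ z × Star _↦_ z hub
  monitored-tour f ε s seen = _ , _ , from Bool.T-≡ (sym seen) , ε , s , ε
  monitored-tour f {v} {p} (_◅_ {j = _ , _ , b} (s , n , eq) path) last seen with f (code e v) p in success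
  monitored-tour f (_◅_ {j = _ , _ , true} (s , n , refl) path) last seen | true =
    _ , _ , from Bool.T-≡ success , ε , (s , n) , unwatch f path ◅◅ last ◅ ε
  monitored-tour f (_◅_ {j = _ , _ , false} (s , n , refl) path) last seen | false =
    let y , z , h , path′ , rest = monitored-tour f path last seen
    in y , z , h , (s , n) ◅ path′ , rest

  sound : ∀ {v} → Accepts (code (suc e) v) → Σ (MaxPath (G I) v) λ π → psat I π 0 φ
  sound {v} (t , accepted , (just i , r) , (_ , first , nodes) , recurrent) =
    let u , q , path , step , next = Track.expand first nodes
    in lasso-sound (path ◅◅ (step , next) ◅ ε)
         (All.map⁺ (All.map (λ {f} (_ , first , nodes) →
           let _ , _ , path , step , next , seen =
                 Watch.expand f (subst (λ c → Monitor.First f c _ _) (γ≡ i) first) nodes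
           in monitored-tour f path (step , next) seen) recurrent))
         (subst (λ c → T (eval φ c t)) (pr-code e v) accepted)
  sound {v} (t , accepted , (nothing , r) , (_ , first , nodes) , _)
    with u , q , path , (w , (s , b) , back) , next , next-r , fulfilled ← Track.expand first nodes =
    lasso-sound (path ◅◅ (s , next) ◅ ε)
      (All.map⁺ (All.map (λ success → (u , r) , (w , r) , success , circle (descend e s b) back , (s , next-r) , ε)
        (_∷_ {P = λ f → T (f (code e u) r)} {x = λ _ _ → true} tt fulfilled)))
      (subst (λ c → T (eval φ c t)) (pr-code e v) accepted)
    where
    -- A vertex of the cycle has a code both below and above that of `u`, so the letter never
    -- changes and the state `r` is kept.
    circle : ∀ {y} → code e y ≼ code e u → Star BlankStep y u → Star _↦_ (y , r) (u , r)
    circle y≼u ε = ε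
    circle {y} y≼u p@((s , b) ◅ p′) =
      (s , subst (λ c → Next φ c r r) (≼-antisym (descends e p) y≼u) next-r) ◅
      circle (≼-trans (descend e s b) y≼u) p′

module _ {k : ℕ} (I : Instance k) where
  open System I
  open Codes k

  -- The recursion is lexicographic: `e` drops at `Ex`, where correctness is needed for all state
  -- formulas of depth at most the smaller `e`; otherwise the formula shrinks.
  sat-correct : ∀ e (γ : Fin k → Code e) → (∀ i → γ i ≡ code e (g I i)) →
                ∀ s v → sdepth s ≤ e → T (sat e γ (code e v) s) ⇔ ssat I v s
  sat-correct e γ γ≡ (atom i) v d = mk⇔
    (λ h → lab-suc (trans (sym (label-code e v)) (toWitness h)))
    (λ eq → fromWitness (trans (label-code e v) (trans (cong lab eq) (lab-g i))))
  sat-correct e γ γ≡ tt v d = mk⇔ (λ _ → tt) (λ _ → tt)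
  sat-correct e γ γ≡ (¬s s) v d = mk⇔
    (λ h h′ → contradiction (trans (sym (to Bool.T-≡ h)) (cong not (to Bool.T-≡ (from eq h′)))) λ ())
    (λ h → from Bool.T-≡ (cong not (Bool.¬-not λ b → h (to eq (from Bool.T-≡ b)))))
    where eq = sat-correct e γ γ≡ s v d
  sat-correct e γ γ≡ (s ∧s s′) v d = mk⇔
    (λ h → let p , q = to Bool.T-∧ h in to eq p , to eq′ q)
    (λ (p , q) → from Bool.T-∧ (from eq p , from eq′ q))
    where
    eq  = sat-correct e γ γ≡ s v (m⊔n≤o⇒m≤o (sdepth s) (sdepth s′) d)
    eq′ = sat-correct e γ γ≡ s′ v (m⊔n≤o⇒n≤o (sdepth s) (sdepth s′) d)
  sat-correct (suc e) γ γ≡ (Ex φ) v (s≤s d) = mk⇔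
    (λ h → MC.sound (toWitness h))
    (λ (π , h) → let ρ , eq = Unrolling.unroll I π in fromWitness (MC.Completeness.complete ρ (to (eq φ) h)))
    where
    module MC = ModelChecking I e (sat e (pr ∘ γ))
      (λ v s → sat-correct e (pr ∘ γ) (λ i → trans (cong pr (γ≡ i)) (pr-code e (g I i))) s v) γ γ≡ φ d

-- The quotient by codes

mkInstance : ∀ {k m} (E : Fin m → Fin m → Bool) → (∀ v → E v v ≡ false) → Fin m →
             (g : Fin k → Fin m) → Injective _≡_ _≡_ g → Instance k
mkInstance E noLoop x g distinct = record
  { G = record { n = _ ; E = E ; x = x ; noLoop = noLoop } ; g = g ; distinct = distinct }

-- Enumeration of the instances with `m` vertices.

module Enumeration (k m : ℕ) where

  -- Clearing the diagonal makes every number decode to a graph without self-loops.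
  decodeE : Fin (2 ^ (m * m)) → Fin m → Fin m → Bool
  decodeE a v w = not (isYes (v Fin.≟ w)) ∧ isYes (finToFun a (combine v w) Fin.≟ suc zero)

  decodeE-noLoop : ∀ a v → decodeE a v v ≡ false
  decodeE-noLoop a v with v Fin.≟ v
  ... | yes _   = refl
  ... | no  v≢v = contradiction refl v≢v

  injective? : (g : Fin k → Fin m) → Dec (∀ i j → g i ≡ g j → i ≡ j)
  injective? g = Fin.all? λ i → Fin.all? λ j → (g i Fin.≟ g j) →-dec (i Fin.≟ j)

  decode : Fin (2 ^ (m * m)) × Fin (m ^ k) × Fin m → List (Instance k)
  decode (a , b , v) with injective? (finToFun b)
  ... | yes inj = mkInstance (decodeE a) (decodeE-noLoop a) v (finToFun b) (λ {i} {j} → inj i j) ∷ []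
  ... | no _    = []

  instances : List (Instance k)
  instances = concatMap decode (proj₁ (finite-× finite-Fin (finite-× finite-Fin finite-Fin)))

  -- Without function extensionality an instance is enumerated only up to pointwise equality.
  instances-complete : (P : Instance k → Set) (E : Fin m → Fin m → Bool) (v : Fin m) (g : Fin k → Fin m) →
    (∀ w → E w w ≡ false) → Injective _≡_ _≡_ g →
    (∀ E′ noLoop g′ (distinct : Injective _≡_ _≡_ g′) → (∀ u w → E′ u w ≡ E u w) → (∀ i → g′ i ≡ g i) →
      P (mkInstance E′ noLoop v g′ distinct)) →
    Any P instances
  instances-complete P E v g noLoop inj holds =
    Any.concatMap⁺ decode (lose (proj₂ (finite-× finite-Fin (finite-× finite-Fin finite-Fin)) (a , b , v)) found)
    where
    bits : Fin (m * m) → Fin 2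
    bits vw = Codes.toBit k (let v , w = remQuot {m} m vw in E v w)
    a = funToFin bits
    b = funToFin g
    g≡ : ∀ i → finToFun b i ≡ g i
    g≡ = Fin.finToFun-funToFin g
    isOne : ∀ c → isYes (Codes.toBit k c Fin.≟ suc zero) ≡ c
    isOne false = refl
    isOne true  = refl
    E≡ : ∀ u w → decodeE a u w ≡ E u w
    E≡ u w with u Fin.≟ w
    ... | yes refl = sym (noLoop u)
    ... | no  _    = trans
      (cong (λ c → isYes (c Fin.≟ suc zero)) (trans (Fin.finToFun-funToFin bits (combine u w))
        (cong (λ vw → Codes.toBit k (E (proj₁ vw) (proj₂ vw))) (Fin.remQuot-combine u w)))) (isOne (E u w))
    found : Any P (decode (a , b , v))
    found with injective? (finToFun b)
    ... | yes inj′ = here (holds _ _ _ _ E≡ g≡)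
    ... | no  ¬inj = contradiction
      (λ i j eq → inj (trans (sym (g≡ i)) (trans eq (g≡ j)))) ¬inj

-- The quotient graph and its relation to the instance.

module Quotient {k} (I : Instance k) (d : ℕ) where
  open Codes k
  module S = System I

  -- All codes are kept, realised or not, so that the size depends on `k` and `d` alone.
  size : ℕ
  size = #codes d * 2

  class : Fin size → Code d
  class q = ⟨ proj₁ (remQuot {#codes d} 2 q) ⟩

  side : Fin size → Fin 2
  side q = proj₂ (remQuot {#codes d} 2 q)

  vertex : Code d → Fin 2 → Fin size
  vertex c b = combine (Code.index c) b

  class-vertex : ∀ c b → class (vertex c b) ≡ c
  class-vertex c b = cong (⟨_⟩ ∘ proj₁) (Fin.remQuot-combine (Code.index c) b)

  side-vertex : ∀ c b → side (vertex c b) ≡ b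
  side-vertex c b = cong proj₂ (Fin.remQuot-combine (Code.index c) b)

  vertex-class : ∀ q → vertex (class q) (side q) ≡ q
  vertex-class q = Fin.combine-remQuot {#codes d} 2 q

  -- A class is always entered on side `zero`, where its mark sits if it has one.
  Change : Fin size → Fin size → Set
  Change q q′ = class q ≢ class q′ × side q′ ≡ zero ×
    ∃₂ λ v v′ → S.code d v ≡ class q × S.code d v′ ≡ class q′ × S.Step v v′

  Swing : Fin size → Fin size → Set
  Swing q q′ = class q ≡ class q′ × side q ≢ side q′ × ∃ λ v → S.code d v ≡ class q × S.Loop v

  -- One copy of each code would suffice but for the absence of self-loops: where a run may
  -- stay in a class forever, it alternates between the two copies.
  Link : Fin size → Fin size → Set
  Link q q′ = Change q q′ ⊎ Swing q q′

  link? : Decidable₂ Link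
  link? q q′ =
    (¬? (class q ≟ᶜ class q′) ×-dec (side q′ Fin.≟ zero ×-dec
      ∃? finite-Fin λ v → ∃? finite-Fin λ v′ →
        S.code d v ≟ᶜ class q ×-dec (S.code d v′ ≟ᶜ class q′ ×-dec S.step? v v′)))
    ⊎-dec
    (class q ≟ᶜ class q′ ×-dec (¬? (side q Fin.≟ side q′) ×-dec
      ∃? finite-Fin λ v → S.code d v ≟ᶜ class q ×-dec S.loop? v))

  edges : Fin size → Fin size → Bool
  edges q q′ = isYes (link? q q′)

  edges-noLoop : ∀ q → edges q q ≡ false
  edges-noLoop q = trans (isYes≗does (link? q q)) (dec-false (link? q q)
    λ { (inj₁ (neq , _)) → neq refl ; (inj₂ (_ , neq , _)) → neq refl })

  home : S.V → Fin size
  home v = vertex (S.code d v) zero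

  same-lab : ∀ {v w} → S.code d v ≡ S.code d w → S.lab v ≡ S.lab w
  same-lab {v} {w} eq = trans (sym (S.label-code d v)) (trans (cong label eq) (S.label-code d w))

  marks-injective : Injective _≡_ _≡_ (home ∘ g I)
  marks-injective {i} {j} eq = Fin.suc-injective (trans (sym (S.lab-g i)) (trans
    (same-lab (trans (sym (class-vertex _ zero)) (trans (cong class eq) (class-vertex _ zero)))) (S.lab-g j)))

  lower : ∀ {e} → e ≤ d → ∀ {v w} → S.code d v ≡ S.code d w → S.code e v ≡ S.code e w
  lower e≤d = go d e≤d
    where
    go : ∀ {e} d → e ≤ d → ∀ {v w} → S.code d v ≡ S.code d w → S.code e v ≡ S.code e w
    go d e≤d {v} {w} eq with m≤n⇒m<n∨m≡n e≤d
    ... | inj₂ refl = eq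
    go (suc d) _ {v} {w} eq | inj₁ (s≤s e≤d) =
      go d e≤d (trans (sym (S.pr-code d v)) (trans (cong pr eq) (S.pr-code d w)))

  successor : ∀ v → ∃ λ w → S.Step v w
  successor v with Fin.any? (λ w → Bool.T? (E (G I) v w))
  ... | yes (w , edge) = w , inj₁ edge
  ... | no  none       = v , inj₂ (refl , λ w edge → none (w , edge))

  walk : S.V → ℕ → S.V
  walk v zero    = v
  walk v (suc i) = proj₁ (successor (walk v i))

  -- Otherwise a walk inside the class would never repeat a vertex.
  trapped : ∀ {c v} → S.code d v ≡ c → S.Blank v →
            (∀ {u w} → S.code d u ≡ c → S.Step u w → S.code d w ≡ c) → ∃ λ u → S.code d u ≡ c × S.Loop u
  trapped {c} {v} v∈c v-blank closed with i , j , i<j , eq ← Fin.pigeonhole (n<1+n _) (walk v ∘ toℕ) =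
    walk v (toℕ i) , walk∈c (toℕ i) ,
    walk v (suc (toℕ i)) , walk-step (toℕ i) , subst (Star S.BlankStep _) (sym eq) (stroll i<j)
    where
    walk∈c : ∀ i → S.code d (walk v i) ≡ c
    walk∈c zero    = v∈c
    walk∈c (suc i) = closed (walk∈c i) (proj₂ (successor (walk v i)))
    walk-step : ∀ i → S.BlankStep (walk v i) (walk v (suc i))
    walk-step i = proj₂ (successor (walk v i)) ,
      trans (same-lab (trans (walk∈c (suc i)) (sym v∈c))) v-blank
    stroll : ∀ {i j} → i ≤ j → Star S.BlankStep (walk v i) (walk v j)
    stroll {i} i≤j with o , refl ← m≤n⇒∃[o]m+o≡n i≤j = go i o
      where
      go : ∀ i o → Star S.BlankStep (walk v i) (walk v (i + o))
      go i zero    rewrite +-identityʳ i = ε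
      go i (suc o) rewrite +-suc i o = walk-step i ◅ go (suc i) o

  module Correspondence
    (E′ : Fin size → Fin size → Bool) (E′-noLoop : ∀ q → E′ q q ≡ false)
    (g′ : Fin k → Fin size) (g′-distinct : Injective _≡_ _≡_ g′)
    (E′≡ : ∀ q q′ → E′ q q′ ≡ edges q q′) (g′≡ : ∀ i → g′ i ≡ home (g I i)) where

    J : Instance k
    J = mkInstance E′ E′-noLoop (home (x (G I))) g′ g′-distinct

    module Q = System J

    link : ∀ {q q′} → Edge (G J) q q′ → Link q q′
    link {q} {q′} e = toWitness {a? = link? q q′} (subst T (E′≡ q q′) e)

    edge : ∀ {q q′} → Link q q′ → Edge (G J) q q′
    edge {q} {q′} l = subst T (sym (E′≡ q q′)) (fromWitness {a? = link? q q′} l)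

    infix 4 _∼_
    -- Equal classes are not enough: in the class of a marked vertex, the copy on the other side
    -- carries no mark.
    _∼_ : Fin size → S.V → Set
    q ∼ v = S.code d v ≡ class q × Q.lab q ≡ S.lab v

    class-g′ : ∀ i → class (g′ i) ≡ S.code d (g I i)
    class-g′ i = trans (cong class (g′≡ i)) (class-vertex _ zero)

    ∼-blank : ∀ {q v} → S.code d v ≡ class q → S.Blank v → q ∼ v
    ∼-blank {q} {v} eq b with Q.blank-or-g q
    ... | inj₁ b′         = eq , trans b′ (sym b)
    ... | inj₂ (i , refl) = contradiction (trans (same-lab (trans (sym (class-g′ i)) (sym eq))) b) S.¬blank-g

    ∼-home : ∀ {q v} → S.code d v ≡ class q → side q ≡ zero → q ∼ v
    ∼-home {q} {v} eq s with S.blank-or-g v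
    ... | inj₁ b          = ∼-blank eq b
    ... | inj₂ (i , refl) = eq , trans (cong Q.lab q≡) (trans (Q.lab-g i) (sym (S.lab-g i)))
      where
      q≡ : q ≡ g′ i
      q≡ = trans (sym (vertex-class q)) (trans (cong₂ vertex (sym eq) s) (sym (g′≡ i)))

    home-∼ : ∀ v → home v ∼ v
    home-∼ v = ∼-home (sym (class-vertex _ zero)) (side-vertex _ zero)

    ∼-same : ∀ {q v u} → q ∼ v → S.code d u ≡ class q → q ∼ u
    ∼-same (c≡ , l≡) eq = eq , trans l≡ (same-lab (trans c≡ (sym eq)))

    g′-∼ : ∀ i → g′ i ∼ g I i
    g′-∼ i = subst (_∼ g I i) (sym (g′≡ i)) (home-∼ (g I i))

    ∼-g : ∀ {i v} → g′ i ∼ v → v ≡ g I i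
    ∼-g {i} (_ , l≡) = S.lab-suc (trans (sym l≡) (Q.lab-g i))

    g-∼ : ∀ {i q} → q ∼ g I i → q ≡ g′ i
    g-∼ {i} (_ , l≡) = Q.lab-suc (trans l≡ (S.lab-g i))

    edge-home : ∀ {q v w} → q ∼ v → S.Step v w → S.code d w ≢ class q → Edge (G J) q (home w)
    edge-home {q} {v} {w} (c≡ , _) s neq = edge (inj₁
      ((λ eq → neq (trans (sym (class-vertex _ zero)) (sym eq))) , side-vertex _ zero ,
       v , w , c≡ , sym (class-vertex _ zero) , s))

    -- A change of class is witnessed by a step from some `u` in the class, in general not from `v`;
    -- `transfer` makes up for the difference.
    step-cases : ∀ {q q′ v} → q ∼ v → Q.Step q q′ →
      (class q ≡ class q′ × q′ ∼ v) ⊎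
      (class q ≢ class q′ × ∃₂ λ u u′ → q ∼ u × S.Step u u′ × q′ ∼ u′)
    step-cases q∼v (inj₂ (refl , _)) = inj₁ (refl , q∼v)
    step-cases q∼v (inj₁ e) with link e
    ... | inj₁ (neq , s≡ , u , u′ , c≡ , c≡′ , s) =
      inj₂ (neq , u , u′ , ∼-same q∼v c≡ , s , ∼-home c≡′ s≡)
    ... | inj₂ (eq , _ , u , c≡ , loop) =
      inj₁ (eq , ∼-blank (trans (proj₁ q∼v) eq) (trans (same-lab (trans (proj₁ q∼v) (sym c≡))) (S.loop-blank loop)))

    -- The code determines the label, so a marked vertex is alone in its class and edges out of
    -- `g′ i` come from edges out of `g I i`.
    dead-g : ∀ {i} → S.Dead (g I i) ⇔ Q.Dead (g′ i)
    dead-g {i} = mk⇔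
      (λ dead q′ e → to-dead dead q′ (link e))
      (λ dead w e → dead _ (edge-home (g′-∼ i) (inj₁ e) λ eq →
        contradiction (subst (λ w → T (E (G I) (g I i) w)) (S.lab-suc {i = i} (trans (same-lab (trans eq (class-g′ i))) (S.lab-g i))) e)
                      (subst T (noLoop (G I) (g I i)))))
      where
      to-dead : S.Dead (g I i) → ∀ q′ → Link (g′ i) q′ → ⊥
      to-dead dead q′ (inj₁ (neq , _ , u , u′ , c≡ , c≡′ , s)) with refl ← ∼-g (∼-same (g′-∼ i) c≡) | s
      ... | inj₁ e          = dead _ e
      ... | inj₂ (refl , _) = neq (trans (sym c≡) c≡′)
      to-dead dead q′ (inj₂ (_ , _ , u , c≡ , loop)) with refl ← ∼-g (∼-same (g′-∼ i) c≡) =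
        S.¬blank-g (S.loop-blank loop)

    lift-exit : ∀ {q v i} → q ∼ v → S.Step v (g I i) → Q.Step q (g′ i)
    lift-exit {q} {v} {i} q∼v s with S.code d (g I i) ≟ᶜ class q
    ... | no neq = inj₁ (subst (Edge (G J) q) (sym (g′≡ i)) (edge-home q∼v s neq))
    -- Here `q` is `g′ i` and `v` is `g I i`, so the step can only repeat a dead vertex.
    ... | yes eq with refl ← g-∼ (∼-same q∼v eq) with refl ← ∼-g q∼v | s
    ...   | inj₁ e          = contradiction e (subst T (noLoop (G I) (g I i)))
    ...   | inj₂ (_ , dead) = inj₂ (refl , to dead-g dead)

    exit : ∀ {q v i} → q ∼ v → Q.Step q (g′ i) → ∃ λ u → S.code d u ≡ class q × S.Step u (g I i)
    exit {q} {v} {i} q∼v s with step-cases q∼v s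
    ... | inj₂ (_ , u , u′ , q∼u , s′ , q′∼u′) = u , proj₁ q∼u , subst (S.Step u) (∼-g q′∼u′) s′
    ... | inj₁ (_ , q′∼v) with refl ← ∼-g q′∼v with refl ← g-∼ q∼v | s
    ...   | inj₁ e          = contradiction e (subst T (E′-noLoop (g′ i)))
    ...   | inj₂ (_ , dead) = g I i , proj₁ q∼v , inj₂ (refl , from dead-g dead)

    lift-loop : ∀ {q v} → q ∼ v → S.Loop v → Q.Loop q
    lift-loop {q} {v} q∼v@(c≡ , l≡) loop =
      -- The cycle swings to the other copy of the class and back.
      q̄ , (inj₁ (edge (inj₂ (q̄-class , q̄-side ∘ sym , v , c≡ , loop))) , q̄-blank) ,
      (inj₁ (edge (inj₂ (sym q̄-class , q̄-side , v , trans c≡ q̄-class , loop))) , trans l≡ (S.loop-blank loop)) ◅ ε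
      where
      other : Fin 2 → Fin 2
      other zero       = suc zero
      other (suc zero) = zero
      other-≢ : ∀ b → other b ≢ b
      other-≢ zero       ()
      other-≢ (suc zero) ()
      q̄ = vertex (class q) (other (side q))
      q̄-class : class q ≡ class q̄
      q̄-class = sym (class-vertex _ _)
      q̄-side : side q̄ ≢ side q
      q̄-side eq = other-≢ (side q) (trans (sym (side-vertex _ _)) eq)
      q̄-blank : Q.Blank q̄
      q̄-blank = trans (proj₂ (∼-blank (trans c≡ q̄-class) (S.loop-blank loop))) (S.loop-blank loop)

    class-descends : ∀ {q q′ v} → q ∼ v → Star Q.BlankStep q q′ → class q′ ≼ class q
    class-descends q∼v ε = ≼-refl
    class-descends q∼v ((s , b) ◅ p) with step-cases q∼v s
    ... | inj₁ (eq , q′∼v) = subst (_ ≼_) (sym eq) (class-descends q′∼v p)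
    ... | inj₂ (_ , u , u′ , (c≡ , _) , s′ , q′∼u′@(c≡′ , l≡)) = ≼-trans (class-descends q′∼u′ p)
      (subst₂ _≼_ c≡′ c≡ (S.descend d s′ (trans (sym l≡) b)))

    -- Classes descend along a blank cycle, so it stays in one class. Its first step is then a
    -- swing, which a loop witnesses, or repeats a dead node, whose class no step leaves, so that
    -- `trapped` applies.
    loop : ∀ {q v} → q ∼ v → Q.Loop q → ∃ λ u → S.code d u ≡ class q × S.Loop u
    loop {q} {v} q∼v ℓ@(q′ , (s , b) , back) with step-cases q∼v s
    ... | inj₂ (neq , _ , _ , _ , _ , q′∼u′) =
      contradiction (≼-antisym (class-descends q′∼u′ back) (class-descends q∼v ((s , b) ◅ ε))) neq
    ... | inj₁ (eq , _) with s
    ...   | inj₁ e with link e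
    ...     | inj₁ (neq , _)                = contradiction eq neq
    ...     | inj₂ (_ , _ , u , c≡ , loop)  = u , c≡ , loop
    loop {q} {v} q∼v ℓ | inj₁ _ | inj₂ (_ , dead) = trapped (proj₁ q∼v) (trans (sym (proj₂ q∼v)) (Q.loop-blank ℓ)) closed
      where
      closed : ∀ {u w} → S.code d u ≡ class q → S.Step u w → S.code d w ≡ class q
      closed {u} {w} u∈ s with S.code d w ≟ᶜ class q
      ... | yes eq = eq
      ... | no neq = contradiction (edge-home (∼-same q∼v u∈) s neq) (dead _)

    lift-leaves : ∀ {q v} x → q ∼ v → S.Leaves v x → Q.Leaves q x
    lift-leaves (just i) = lift-exit
    lift-leaves nothing  = lift-loop

    leaves : ∀ {q v} x → q ∼ v → Q.Leaves q x → ∃ λ u → S.code d u ≡ class q × S.Leaves u x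
    leaves (just i) = exit
    leaves nothing  = loop

    module _ {e} (e<d : e < d) (code≡ : ∀ {q v} → q ∼ v → Q.code e q ≡ S.code e v) where

      -- As `e < d`, equal codes at depth `d` give equal codes at depth `suc e`, and these record
      -- the same segments.
      transfer : ∀ {q u v ws x} → q ∼ u → q ∼ v → S.Seg (S.code e) u ws x → S.Seg (S.code e) v ws x
      transfer (c≡ , _) (c≡′ , _) p = S.Lang⇒Seg e
        (subst (λ c → Lang c _ _) (lower e<d (trans c≡ (sym c≡′))) (S.Seg⇒Lang e p))

      lift-seg : ∀ {q v ws x} → q ∼ v → S.Seg (S.code e) v ws x → Q.Seg (Q.code e) q ws x
      lift-seg {x = x} q∼v (S.leave l) =
        subst (λ c → Q.Seg (Q.code e) _ (c ∷ []) x) (code≡ q∼v) (Q.leave (lift-leaves x q∼v l))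
      lift-seg {q} q∼v (S.stutter {w} s b eq p) with S.code d w ≟ᶜ class q
      -- A step inside the class is dropped: the node stays put and the word is unchanged.
      ... | yes same = lift-seg (∼-same q∼v same) p
      ... | no  diff = Q.stutter (inj₁ (edge-home q∼v s diff)) (trans (proj₂ (home-∼ w)) b)
        (trans (code≡ (home-∼ w)) (trans eq (sym (code≡ q∼v)))) (lift-seg (home-∼ w) p)
      lift-seg {q} {x = x} q∼v (S.move {w} {ws} s b neq p) with S.code d w ≟ᶜ class q
      ... | yes same = contradiction (lower (<⇒≤ e<d) (trans same (sym (proj₁ q∼v)))) neq
      ... | no  diff = subst (λ c → Q.Seg (Q.code e) q (c ∷ ws) x) (code≡ q∼v)
        (Q.move (inj₁ (edge-home q∼v s diff)) (trans (proj₂ (home-∼ w)) b)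
          (λ eq → neq (trans (sym (code≡ (home-∼ w))) (trans eq (code≡ q∼v)))) (lift-seg (home-∼ w) p))

      -- The tail is lowered first, to the target `u′` of the witnessing step; the step from `u` is
      -- put in front, and the result is transferred from `u` to `v`.
      lower-seg : ∀ {q v ws x} → q ∼ v → Q.Seg (Q.code e) q ws x → S.Seg (S.code e) v ws x
      lower-seg {q} {x = x} q∼v (Q.leave l) with u , c≡ , l′ ← leaves x q∼v l =
        transfer (∼-same q∼v c≡) q∼v
          (subst (λ c → S.Seg (S.code e) u (c ∷ []) x) (sym (code≡ (∼-same q∼v c≡))) (S.leave l′))
      lower-seg q∼v (Q.stutter s b eq p) with step-cases q∼v s
      ... | inj₁ (_ , q′∼v) = lower-seg q′∼v p
      ... | inj₂ (_ , u , u′ , q∼u , s′ , q′∼u′) = transfer q∼u q∼v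
        (S.stutter s′ (trans (sym (proj₂ q′∼u′)) b)
          (trans (sym (code≡ q′∼u′)) (trans eq (code≡ q∼u))) (lower-seg q′∼u′ p))
      lower-seg {x = x} q∼v (Q.move {ws = ws} s b neq p) with step-cases q∼v s
      ... | inj₁ (_ , q′∼v) = contradiction (trans (code≡ q′∼v) (sym (code≡ q∼v))) neq
      ... | inj₂ (_ , u , u′ , q∼u , s′ , q′∼u′) = transfer q∼u q∼v
        (subst (λ c → S.Seg (S.code e) u (c ∷ ws) x) (sym (code≡ q∼u))
          (S.move s′ (trans (sym (proj₂ q′∼u′)) b)
            (λ eq → neq (trans (code≡ q′∼u′) (trans eq (sym (code≡ q∼u))))) (lower-seg q′∼u′ p)))

    code-agrees : ∀ e → e ≤ d → ∀ {q v} → q ∼ v → Q.code e q ≡ S.code e v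
    code-agrees zero    _   (_ , l≡) = cong ⟨_⟩ l≡
    code-agrees (suc e) e<d {q} {v} q∼v = ≼-antisym
      (lex (≡⇒≼ prs) λ _ i b → S.Seg⇒bit e i (lower-seg e<d IH q∼v (Q.bit⇒Seg e i b)))
      (lex (≡⇒≼ (sym prs)) λ _ i b → Q.Seg⇒bit e i (lift-seg e<d IH q∼v (S.bit⇒Seg e i b)))
      where
      IH : ∀ {q v} → q ∼ v → Q.code e q ≡ S.code e v
      IH = code-agrees e (<⇒≤ e<d)
      prs : pr (Q.code (suc e) q) ≡ pr (S.code (suc e) v)
      prs = trans (Q.pr-code e q) (trans (IH q∼v) (sym (S.pr-code e v)))
      ≡⇒≼ : ∀ {e} {c c′ : Code e} → c ≡ c′ → c ≼ c′
      ≡⇒≼ refl = ≼-refl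

    -- One Boolean, computed from codes that both instances share, decides `s` in each of them.
    equivalent : CTLEquiv d I J
    equivalent s depth = to J⇔ ∘ from I⇔ , to I⇔ ∘ from J⇔
      where
      sat-I : Bool
      sat-I = sat d (S.code d ∘ g I) (S.code d (x (G I))) s
      I⇔ : T sat-I ⇔ I ⊨ s
      I⇔ = sat-correct I d _ (λ _ → refl) s _ depth
      J⇔ : T sat-I ⇔ J ⊨ s
      J⇔ = subst (λ c → T (sat d (S.code d ∘ g I) c s) ⇔ J ⊨ s) (code-agrees d ≤-refl (home-∼ _))
        (sat-correct J d _ (λ i → sym (code-agrees d ≤-refl (g′-∼ i))) s _ depth)

theorem7 : ∀ (k d : ℕ) → 1 ≤ k → 1 ≤ d → FinitelyManyClasses {k} (CTLEquiv d)
theorem7 k d _ _ = instances , λ I → let open Quotient I d in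
  instances-complete (CTLEquiv d I) edges (home (x (G I))) (home ∘ g I) edges-noLoop marks-injective
    λ E′ noLoop g′ distinct E′≡ g′≡ → Correspondence.equivalent E′ noLoop g′ distinct E′≡ g′≡
  where open Enumeration k (Codes.#codes k d * 2)
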